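{- Let $p$ be prime, $n\ge1$, $G=G(p,n)$ the Heisenberg group acting on $X=\mathbb{Z}_p^{n+2}$ by matrix–vector multiplication with permutation representation $V=\mathbb{C}^X$, and let $H=\{(0,0,z):z\in\mathbb{Z}_p\}$ be the center of $G$. Then the coset identification problem for $H$ (given oracle access to the permutation matrix of an unknown $a=(x,y,z)\in G$, determine the coset $aH$, i.e. determine $x$ and $y$) can be solved by a single-query quantum algorithm with success probability $1$.
   Context: $G(p,n)$ is the group of $(n+2)\times(n+2)$ matrices over $\mathbb{Z}_p$ with $1$'s on the diagonal whose only other nonzero entries lie in the first row and last column, identified with triples $(x,y,z)$, $x,y\in\mathbb{Z}_p^n$, $z\in\mathbb{Z}_p$, where $(1,x,z)$ is the first row and $(z,y,1)^T$ the last column. A single-query algorithm consists of $N\ge1$, a unit vector $\psi\in V\otimes\mathbb{C}^N$, a unitary $U_1$ and a POVM indexed by the cosets of $H$; it succeeds with probability $\frac1{|G|}\sum_a\langle\psi_a|E_{aH}|\psi_a\rangle$ where $\psi_a=U_1(\pi(a)\otimes I)\psi$. -}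

module Defs where

open import Algebra.Structures using (IsGroup)
open import Data.Fin.Base using (Fin; toℕ)
import Data.Fin.Properties as Fin
open import Data.Integer.Base using (1ℤ)
open import Data.List.Base
  using (List; []; _∷_; length; foldr; deduplicate; allFin; cartesianProduct; cartesianProductWith)
open import Data.List.Membership.Propositional using (_∈_)
open import Data.List.Membership.Propositional.Properties
  using (∈-allFin; ∈-cartesianProduct⁺; ∈-cartesianProductWith⁺; ∈-length)
open import Data.List.Relation.Unary.Any using (here)
import Data.List.Relation.Unary.All as All
import Data.List.Relation.Unary.AllPairs as AllPairs
open import Data.List.Relation.Unary.Unique.Propositional using (Unique)
import Data.List.Relation.Unary.Unique.Propositional.Properties as Uniq
open import Data.Nat.Base as ℕ using (ℕ; zero; suc; NonZero; _⊔_)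
import Data.Nat.Properties as ℕ
open import Data.Nat.DivMod
  using (_%_; _mod_; m<n⇒m%n≡m; %-distribˡ-+; %-distribˡ-*; n%n≡0; m%n<n)
open import Data.Product.Base using (Σ; ∃; _×_; _,_; proj₁; proj₂)
import Data.Product.Properties as Prod
open import Data.Rational.Base as ℚ using (ℚ; 0ℚ; 1ℚ; ½; Positive)
import Data.Rational.Properties as ℚ
open import Data.Rational.Solver using (module +-*-Solver)
open import Data.Vec.Base using (Vec; []; _∷_; _∷ʳ_; map; zipWith; replicate; initLast)
import Data.Vec.Properties as Vec
open import Level using (0ℓ)
open import Relation.Binary.Definitions using (DecidableEquality)
open import Relation.Binary.PropositionalEquality
open import Relation.Nullary.Decidable.Core using (Dec; does; _×-dec_)
open import Relation.Unary using (Pred; Decidable)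
open import Data.Bool.Base using (if_then_else_)

-- Real numbers: Cauchy sequences of rationals, with the (setoid)
-- equality and order of the limits.

Cauchy : (ℕ → ℚ) → Set
Cauchy s = ∀ ε → 0ℚ ℚ.< ε →
  ∃ λ N → ∀ m n → N ℕ.≤ m → N ℕ.≤ n → ℚ.∣ s m ℚ.- s n ∣ ℚ.< ε

private

  abstract

    0<½*_ : ∀ {ε} → 0ℚ ℚ.< ε → 0ℚ ℚ.< ½ ℚ.* ε
    0<½*_ {ε} 0<ε = subst (ℚ._< ½ ℚ.* ε) (ℚ.*-zeroʳ ½) (ℚ.*-monoʳ-<-pos ½ 0<ε)

    ½+½ : ∀ ε → ½ ℚ.* ε ℚ.+ ½ ℚ.* ε ≡ ε
    ½+½ ε = trans (sym (ℚ.*-distribʳ-+ ε ½ ½)) (ℚ.*-identityˡ ε)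

    const-cauchy : ∀ q → Cauchy (λ _ → q)
    const-cauchy q ε 0<ε = 0 , λ _ _ _ _ →
      subst (λ r → ℚ.∣ r ∣ ℚ.< ε) (sym (ℚ.+-inverseʳ q)) 0<ε

    neg-cauchy : ∀ s → Cauchy s → Cauchy (λ n → ℚ.- s n)
    neg-cauchy s cs ε 0<ε with cs ε 0<ε
    ... | N , h = N , λ m n N≤m N≤n →
      subst (ℚ._< ε)
        (trans (sym (ℚ.∣-p∣≡∣p∣ (s m ℚ.- s n))) (cong ℚ.∣_∣ (eq (s m) (s n))))
        (h m n N≤m N≤n)
      where
      open +-*-Solver
      eq : ∀ a b → ℚ.- (a ℚ.- b) ≡ ℚ.- a ℚ.- (ℚ.- b)
      eq = solve 2 (λ a b → :- (a :- b) := :- a :- (:- b)) refl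

    +-cauchy : ∀ s t → Cauchy s → Cauchy t → Cauchy (λ n → s n ℚ.+ t n)
    +-cauchy s t cs ct ε 0<ε
      with cs (½ ℚ.* ε) (0<½* 0<ε) | ct (½ ℚ.* ε) (0<½* 0<ε)
    ... | N , h | M , k = N ⊔ M , λ m n N≤m N≤n → begin-strict
      ℚ.∣ (s m ℚ.+ t m) ℚ.- (s n ℚ.+ t n) ∣
        ≡⟨ cong ℚ.∣_∣ (eq (s m) (t m) (s n) (t n)) ⟩
      ℚ.∣ (s m ℚ.- s n) ℚ.+ (t m ℚ.- t n) ∣
        ≤⟨ ℚ.∣p+q∣≤∣p∣+∣q∣ (s m ℚ.- s n) (t m ℚ.- t n) ⟩
      ℚ.∣ s m ℚ.- s n ∣ ℚ.+ ℚ.∣ t m ℚ.- t n ∣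
        <⟨ ℚ.+-mono-<
             (h m n (ℕ.m⊔n≤o⇒m≤o N M N≤m) (ℕ.m⊔n≤o⇒m≤o N M N≤n))
             (k m n (ℕ.m⊔n≤o⇒n≤o N M N≤m) (ℕ.m⊔n≤o⇒n≤o N M N≤n)) ⟩
      ½ ℚ.* ε ℚ.+ ½ ℚ.* ε ≡⟨ ½+½ ε ⟩
      ε ∎
      where
      open ℚ.≤-Reasoning
      open +-*-Solver
      eq : ∀ a b c d → (a ℚ.+ b) ℚ.- (c ℚ.+ d) ≡ (a ℚ.- c) ℚ.+ (b ℚ.- d)
      eq = solve 4 (λ a b c d → (a :+ b) :- (c :+ d) := (a :- c) :+ (b :- d)) refl

    0<1 : 0ℚ ℚ.< 1ℚ
    0<1 = ℚ.positive⁻¹ 1ℚ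

    cauchy-bounded : ∀ s → Cauchy s →
      ∃ λ K → 0ℚ ℚ.< K × ∃ λ N → ∀ n → N ℕ.≤ n → ℚ.∣ s n ∣ ℚ.≤ K
    cauchy-bounded s cs with cs 1ℚ 0<1
    ... | N , h = 1ℚ ℚ.+ ℚ.∣ s N ∣ , ℚ.+-mono-<-≤ 0<1 (ℚ.0≤∣p∣ (s N)) , N , λ n N≤n → begin
      ℚ.∣ s n ∣                           ≡⟨ cong ℚ.∣_∣ (eq (s n) (s N)) ⟩
      ℚ.∣ (s n ℚ.- s N) ℚ.+ s N ∣         ≤⟨ ℚ.∣p+q∣≤∣p∣+∣q∣ (s n ℚ.- s N) (s N) ⟩
      ℚ.∣ s n ℚ.- s N ∣ ℚ.+ ℚ.∣ s N ∣     ≤⟨ ℚ.+-monoˡ-≤ ℚ.∣ s N ∣ (ℚ.<⇒≤ (h n N N≤n ℕ.≤-refl)) ⟩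
      1ℚ ℚ.+ ℚ.∣ s N ∣                    ∎
      where
      open ℚ.≤-Reasoning
      open +-*-Solver
      eq : ∀ a b → a ≡ (a ℚ.- b) ℚ.+ b
      eq = solve 2 (λ a b → a := (a :- b) :+ b) refl

    *-close : ∀ K δ η a b c d → K ℚ.* δ ≡ η → 0ℚ ℚ.< K →
      ℚ.∣ a ∣ ℚ.≤ K → ℚ.∣ d ∣ ℚ.≤ K → ℚ.∣ b ℚ.- d ∣ ℚ.< δ → ℚ.∣ a ℚ.- c ∣ ℚ.< δ →
      ℚ.∣ a ℚ.* b ℚ.- c ℚ.* d ∣ ℚ.< η ℚ.+ η
    *-close K δ η a b c d Kδ≡η 0<K a≤K d≤K b-d<δ a-c<δ = begin-strict
      ℚ.∣ a ℚ.* b ℚ.- c ℚ.* d ∣                           ≡⟨ cong ℚ.∣_∣ (eq a b c d) ⟩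
      ℚ.∣ a ℚ.* (b ℚ.- d) ℚ.+ d ℚ.* (a ℚ.- c) ∣
        ≤⟨ ℚ.∣p+q∣≤∣p∣+∣q∣ (a ℚ.* (b ℚ.- d)) (d ℚ.* (a ℚ.- c)) ⟩
      ℚ.∣ a ℚ.* (b ℚ.- d) ∣ ℚ.+ ℚ.∣ d ℚ.* (a ℚ.- c) ∣
        <⟨ ℚ.+-mono-< (small a (b ℚ.- d) a≤K b-d<δ) (small d (a ℚ.- c) d≤K a-c<δ) ⟩
      η ℚ.+ η                                             ∎
      where
      open ℚ.≤-Reasoning
      open +-*-Solver
      eq : ∀ a b c d → a ℚ.* b ℚ.- c ℚ.* d ≡ a ℚ.* (b ℚ.- d) ℚ.+ d ℚ.* (a ℚ.- c)
      eq = solve 4 (λ a b c d → a :* b :- c :* d := a :* (b :- d) :+ d :* (a :- c)) refl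

      small : ∀ r q → ℚ.∣ r ∣ ℚ.≤ K → ℚ.∣ q ∣ ℚ.< δ → ℚ.∣ r ℚ.* q ∣ ℚ.< η
      small r q r≤K q<δ = begin-strict
        ℚ.∣ r ℚ.* q ∣          ≡⟨ ℚ.∣p*q∣≡∣p∣*∣q∣ r q ⟩
        ℚ.∣ r ∣ ℚ.* ℚ.∣ q ∣    ≤⟨ ℚ.*-monoʳ-≤-nonNeg ℚ.∣ q ∣ {{ℚ.∣-∣-nonNeg q}} r≤K ⟩
        K ℚ.* ℚ.∣ q ∣          <⟨ ℚ.*-monoʳ-<-pos K {{ℚ.positive 0<K}} q<δ ⟩
        K ℚ.* δ                ≡⟨ Kδ≡η ⟩
        η                      ∎

    divide : ∀ K η → 0ℚ ℚ.< K → 0ℚ ℚ.< η → ∃ λ δ → 0ℚ ℚ.< δ × K ℚ.* δ ≡ η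
    divide K η 0<K 0<η = 1/K ℚ.* η
      , subst (ℚ._< 1/K ℚ.* η) (ℚ.*-zeroʳ 1/K) (ℚ.*-monoʳ-<-pos 1/K {{1/K-pos}} 0<η)
      , trans (sym (ℚ.*-assoc K 1/K η))
          (trans (cong (ℚ._* η) (ℚ.*-inverseʳ K {{K≢0}})) (ℚ.*-identityˡ η))
      where
      K-pos : Positive K
      K-pos = ℚ.positive 0<K
      K≢0 : ℚ.NonZero K
      K≢0 = ℚ.pos⇒nonZero K {{K-pos}}
      1/K : ℚ
      1/K = ℚ.1/_ K {{K≢0}}
      1/K-pos : Positive 1/K
      1/K-pos = ℚ.1/pos⇒pos K {{K-pos}}

    common-bound : ∀ {K L} → 0ℚ ℚ.< K → 0ℚ ℚ.< L →
      ∃ λ B → 0ℚ ℚ.< B × K ℚ.≤ B × L ℚ.≤ B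
    common-bound {K} {L} 0<K 0<L = K ℚ.+ L , ℚ.+-mono-< 0<K 0<L
      , subst (ℚ._≤ K ℚ.+ L) (ℚ.+-identityʳ K) (ℚ.+-monoʳ-≤ K (ℚ.<⇒≤ 0<L))
      , subst (ℚ._≤ K ℚ.+ L) (ℚ.+-identityˡ L) (ℚ.+-monoˡ-≤ L (ℚ.<⇒≤ 0<K))

    *-cauchy : ∀ s t → Cauchy s → Cauchy t → Cauchy (λ n → s n ℚ.* t n)
    *-cauchy s t cs ct ε 0<ε = bounded (cauchy-bounded s cs) (cauchy-bounded t ct)
      where
      η : ℚ
      η = ½ ℚ.* ε

      Goal : Set
      Goal = ∃ λ N → ∀ m n → N ℕ.≤ m → N ℕ.≤ n → ℚ.∣ s m ℚ.* t m ℚ.- s n ℚ.* t n ∣ ℚ.< ε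

      combine : ∀ {K A B C D δ} →
        0ℚ ℚ.< K → K ℚ.* δ ≡ η →
        (∀ n → A ℕ.≤ n → ℚ.∣ s n ∣ ℚ.≤ K) →
        (∀ n → B ℕ.≤ n → ℚ.∣ t n ∣ ℚ.≤ K) →
        (∀ m n → C ℕ.≤ m → C ℕ.≤ n → ℚ.∣ s m ℚ.- s n ∣ ℚ.< δ) →
        (∀ m n → D ℕ.≤ m → D ℕ.≤ n → ℚ.∣ t m ℚ.- t n ∣ ℚ.< δ) →
        Goal
      combine {K} {A} {B} {C} {D} {δ} 0<K Kδ≡η bs bt hs ht =
        (A ⊔ B) ⊔ (C ⊔ D) , λ m n N≤m N≤n →
          subst (ℚ.∣ s m ℚ.* t m ℚ.- s n ℚ.* t n ∣ ℚ.<_) (½+½ ε)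
            (*-close K δ η (s m) (t m) (s n) (t n) Kδ≡η 0<K
              (bs m (ℕ.m⊔n≤o⇒m≤o A B (ℕ.m⊔n≤o⇒m≤o (A ⊔ B) (C ⊔ D) N≤m)))
              (bt n (ℕ.m⊔n≤o⇒n≤o A B (ℕ.m⊔n≤o⇒m≤o (A ⊔ B) (C ⊔ D) N≤n)))
              (ht m n (ℕ.m⊔n≤o⇒n≤o C D (ℕ.m⊔n≤o⇒n≤o (A ⊔ B) (C ⊔ D) N≤m))
                      (ℕ.m⊔n≤o⇒n≤o C D (ℕ.m⊔n≤o⇒n≤o (A ⊔ B) (C ⊔ D) N≤n)))
              (hs m n (ℕ.m⊔n≤o⇒m≤o C D (ℕ.m⊔n≤o⇒n≤o (A ⊔ B) (C ⊔ D) N≤m))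
                      (ℕ.m⊔n≤o⇒m≤o C D (ℕ.m⊔n≤o⇒n≤o (A ⊔ B) (C ⊔ D) N≤n))))

      converge : ∀ {K A B} → 0ℚ ℚ.< K →
        (∀ n → A ℕ.≤ n → ℚ.∣ s n ∣ ℚ.≤ K) →
        (∀ n → B ℕ.≤ n → ℚ.∣ t n ∣ ℚ.≤ K) →
        (∃ λ δ → 0ℚ ℚ.< δ × K ℚ.* δ ≡ η) → Goal
      converge 0<K bs bt (δ , 0<δ , Kδ≡η) =
        combine 0<K Kδ≡η bs bt (proj₂ (cs δ 0<δ)) (proj₂ (ct δ 0<δ))

      bounded :
        (∃ λ K → 0ℚ ℚ.< K × ∃ λ A → ∀ n → A ℕ.≤ n → ℚ.∣ s n ∣ ℚ.≤ K) →
        (∃ λ L → 0ℚ ℚ.< L × ∃ λ B → ∀ n → B ℕ.≤ n → ℚ.∣ t n ∣ ℚ.≤ L) → Goal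
      bounded (K , 0<K , A , bs) (L , 0<L , B , bt) = with-bound (common-bound 0<K 0<L)
        where
        with-bound : (∃ λ M → 0ℚ ℚ.< M × K ℚ.≤ M × L ℚ.≤ M) → Goal
        with-bound (M , 0<M , K≤M , L≤M) = converge {A = A} {B = B} 0<M
          (λ n A≤n → ℚ.≤-trans (bs n A≤n) K≤M)
          (λ n B≤n → ℚ.≤-trans (bt n B≤n) L≤M)
          (divide M η 0<M (0<½* 0<ε))

record ℝ : Set where
  constructor mkℝ
  field
    seq    : ℕ → ℚ
    cauchy : Cauchy seq

open ℝ public

infix  4 _≈ᴿ_ _≤ᴿ_
infixl 6 _+ᴿ_
infixl 7 _*ᴿ_
infix  8 -ᴿ_

_≈ᴿ_ : ℝ → ℝ → Set
x ≈ᴿ y = ∀ ε → 0ℚ ℚ.< ε → ∃ λ N → ∀ n → N ℕ.≤ n → ℚ.∣ seq x n ℚ.- seq y n ∣ ℚ.< ε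

_≤ᴿ_ : ℝ → ℝ → Set
x ≤ᴿ y = ∀ ε → 0ℚ ℚ.< ε → ∃ λ N → ∀ n → N ℕ.≤ n → seq x n ℚ.< seq y n ℚ.+ ε

fromℚ : ℚ → ℝ
fromℚ q = mkℝ (λ _ → q) (const-cauchy q)

_+ᴿ_ _*ᴿ_ : ℝ → ℝ → ℝ
x +ᴿ y = mkℝ (λ n → seq x n ℚ.+ seq y n) (+-cauchy (seq x) (seq y) (cauchy x) (cauchy y))
x *ᴿ y = mkℝ (λ n → seq x n ℚ.* seq y n) (*-cauchy (seq x) (seq y) (cauchy x) (cauchy y))

-ᴿ_ : ℝ → ℝ
-ᴿ x = mkℝ (λ n → ℚ.- seq x n) (neg-cauchy (seq x) (cauchy x))

record ℂ : Set where
  constructor _+i_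
  field
    re im : ℝ

open ℂ public

infix  4 _≈ᶜ_
infixl 6 _+ᶜ_
infixl 7 _*ᶜ_

_≈ᶜ_ : ℂ → ℂ → Set
w ≈ᶜ z = re w ≈ᴿ re z × im w ≈ᴿ im z

_+ᶜ_ _*ᶜ_ : ℂ → ℂ → ℂ
w +ᶜ z = (re w +ᴿ re z) +i (im w +ᴿ im z)
w *ᶜ z = (re w *ᴿ re z +ᴿ -ᴿ (im w *ᴿ im z)) +i (re w *ᴿ im z +ᴿ im w *ᴿ re z)

conj : ℂ → ℂ
conj z = re z +i (-ᴿ im z)

ℚ→ℂ : ℚ → ℂ
ℚ→ℂ q = fromℚ q +i fromℚ 0ℚ

0ᶜ 1ᶜ : ℂ
0ᶜ = ℚ→ℂ 0ℚ
1ᶜ = ℚ→ℂ 1ℚ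

record Finite (A : Set) : Set where
  field
    elements : List A
    complete : ∀ a → a ∈ elements
    unique   : Unique elements
    _≟_      : DecidableEquality A

  ∣_∣ : ℕ
  ∣_∣ = length elements

open Finite

finFin : ∀ n → Finite (Fin n)
finFin n = record
  { elements = allFin n
  ; complete = ∈-allFin
  ; unique   = Uniq.allFin⁺ n
  ; _≟_      = Fin._≟_
  }

infixr 2 _×ᶠ_

_×ᶠ_ : ∀ {A B} → Finite A → Finite B → Finite (A × B)
α ×ᶠ β = record
  { elements = cartesianProduct (elements α) (elements β)
  ; complete = λ (a , b) → ∈-cartesianProduct⁺ (complete α a) (complete β b)
  ; unique   = Uniq.cartesianProduct⁺ (unique α) (unique β)
  ; _≟_      = Prod.≡-dec (_≟_ α) (_≟_ β)
  }

finVec : ∀ {A} → Finite A → ∀ n → Finite (Vec A n)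
finVec α zero = record
  { elements = [] ∷ []
  ; complete = λ { [] → here refl }
  ; unique   = All.[] AllPairs.∷ AllPairs.[]
  ; _≟_      = Vec.≡-dec (_≟_ α)
  }
finVec α (suc n) = record
  { elements = cartesianProductWith _∷_ (elements α) (elements v)
  ; complete = λ { (a ∷ as) → ∈-cartesianProductWith⁺ _∷_ (complete α a) (complete v as) }
  ; unique   = Uniq.cartesianProductWith⁺ _∷_ Vec.∷-injective (unique α) (unique v)
  ; _≟_      = Vec.≡-dec (_≟_ α)
  }
  where v = finVec α n

sumList : ∀ {A : Set} → List A → (A → ℂ) → ℂ
sumList as f = foldr (λ a s → f a +ᶜ s) 0ᶜ as

Vector Operator : Set → Set
Vector I   = I → ℂ
Operator I = I → I → ℂ

infix 4 _≈ᵒ_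

_≈ᵒ_ : ∀ {I} → Operator I → Operator I → Set
A ≈ᵒ B = ∀ i j → A i j ≈ᶜ B i j

module LinearAlgebra {I : Set} (fin : Finite I) where

  ∑ : (I → ℂ) → ℂ
  ∑ = sumList (elements fin)

  infixr 7 _$ᵒ_ _∘ᵒ_

  _$ᵒ_ : Operator I → Vector I → Vector I
  (A $ᵒ v) i = ∑ λ j → A i j *ᶜ v j

  _∘ᵒ_ : Operator I → Operator I → Operator I
  (A ∘ᵒ B) i k = ∑ λ j → A i j *ᶜ B j k

  ⟨_∣_⟩ : Vector I → Vector I → ℂ
  ⟨ u ∣ v ⟩ = ∑ λ i → conj (u i) *ᶜ v i

  idᵒ : Operator I
  idᵒ i j = if does (_≟_ fin i j) then 1ᶜ else 0ᶜ

  _† : Operator I → Operator I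
  (A †) i j = conj (A j i)

  IsUnit : Vector I → Set
  IsUnit v = ⟨ v ∣ v ⟩ ≈ᶜ 1ᶜ

  IsUnitary : Operator I → Set
  IsUnitary U = (U † ∘ᵒ U ≈ᵒ idᵒ) × (U ∘ᵒ U † ≈ᵒ idᵒ)

  IsPositive : Operator I → Set
  IsPositive E = (E † ≈ᵒ E) × (∀ v → fromℚ 0ℚ ≤ᴿ re ⟨ v ∣ E $ᵒ v ⟩)

_⊗_ : ∀ {I J} → Operator I → Operator J → Operator (I × J)
(A ⊗ B) (i , j) (i′ , j′) = A i i′ *ᶜ B j j′

record CosetProblem : Set₁ where
  infixl 7 _∙_
  infixr 6 _▷_
  field
    G       : Set
    _∙_     : G → G → G
    ε       : G
    _⁻¹     : G → G
    isGroup : IsGroup _≡_ _∙_ ε _⁻¹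
    finG    : Finite G

    H       : Pred G 0ℓ
    H?      : Decidable H
    ε∈H     : H ε
    ∙∈H     : ∀ {a b} → H a → H b → H (a ∙ b)
    ⁻¹∈H    : ∀ {a} → H a → H (a ⁻¹)

    X       : Set
    finX    : Finite X
    _▷_     : G → X → X
    ε▷      : ∀ x → ε ▷ x ≡ x
    ∙▷      : ∀ a b x → (a ∙ b) ▷ x ≡ a ▷ (b ▷ x)

  SameCoset : G → G → Set
  SameCoset a b = H (a ⁻¹ ∙ b)

  sameCoset? : ∀ a b → Dec (SameCoset a b)
  sameCoset? a b = H? (a ⁻¹ ∙ b)

  -- one representative of each left coset of H
  transversal : List G
  transversal = deduplicate sameCoset? (elements finG)

  ∣G∣ : ℕ
  ∣G∣ = ∣ finG ∣

  instance
    ∣G∣≢0 : NonZero ∣G∣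
    ∣G∣≢0 = ℕ.>-nonZero (∈-length (complete finG ε))

  π : G → Operator X
  π a y x = if does (_≟_ finX y (a ▷ x)) then 1ᶜ else 0ᶜ

module _ (𝒫 : CosetProblem) where
  open CosetProblem 𝒫

  -- A family indexed by G/H is given as a family indexed by G that depends
  -- only on the coset; completeness then sums over a transversal.
  record CosetPOVM {I : Set} (fin : Finite I) : Set where
    open LinearAlgebra fin
    field
      E             : G → Operator I
      E-cong        : ∀ {a b} → SameCoset a b → E a ≈ᵒ E b
      E-positive    : ∀ a → IsPositive (E a)
      E-complete    : (λ i j → sumList transversal λ a → E a i j) ≈ᵒ idᵒ

  record SingleQueryAlgorithm : Set where
    field
      N    : ℕ
      N≥1  : N ℕ.≥ 1

    finXN : Finite (X × Fin N)
    finXN = finX ×ᶠ finFin N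

    open LinearAlgebra finXN

    field
      ψ          : Vector (X × Fin N)
      ψ-unit     : IsUnit ψ
      U₁         : Operator (X × Fin N)
      U₁-unitary : IsUnitary U₁
      povm       : CosetPOVM finXN

    open CosetPOVM povm

    ψ[_] : G → Vector (X × Fin N)
    ψ[ a ] = U₁ $ᵒ (π a ⊗ LinearAlgebra.idᵒ (finFin N)) $ᵒ ψ

    successProbability : ℂ
    successProbability =
      ℚ→ℂ (1ℤ ℚ./ ∣G∣) *ᶜ sumList (elements finG) λ a → ⟨ ψ[ a ] ∣ E a $ᵒ ψ[ a ] ⟩

  SolvableWithProbability : ℂ → Set
  SolvableWithProbability q =
    Σ SingleQueryAlgorithm λ 𝒜 → SingleQueryAlgorithm.successProbability 𝒜 ≈ᶜ q

module Modular (p : ℕ) {{_ : NonZero p}} where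

  ℤₚ : Set
  ℤₚ = Fin p

  infixl 6 _+_
  infixl 7 _*_
  infix  8 -_

  _+_ _*_ : ℤₚ → ℤₚ → ℤₚ
  i + j = (toℕ i ℕ.+ toℕ j) mod p
  i * j = (toℕ i ℕ.* toℕ j) mod p

  -_ : ℤₚ → ℤₚ
  - i = (p ℕ.∸ toℕ i) mod p

  0# 1# : ℤₚ
  0# = 0 mod p
  1# = 1 mod p

  private
    ⟦_⟧ : ℕ → ℤₚ
    ⟦ k ⟧ = k mod p

    toℕ-⟦⟧ : ∀ k → toℕ ⟦ k ⟧ ≡ k % p
    toℕ-⟦⟧ k = Fin.toℕ-fromℕ< (m%n<n k p)

    ⟦⟧-cong : ∀ {k l} → k % p ≡ l % p → ⟦ k ⟧ ≡ ⟦ l ⟧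
    ⟦⟧-cong eq = Fin.toℕ-injective (trans (toℕ-⟦⟧ _) (trans eq (sym (toℕ-⟦⟧ _))))

    ⟦⟧-toℕ : ∀ i → ⟦ toℕ i ⟧ ≡ i
    ⟦⟧-toℕ i = Fin.toℕ-injective (trans (toℕ-⟦⟧ (toℕ i)) (m<n⇒m%n≡m (Fin.toℕ<n i)))

    ⟦⟧-+ : ∀ k l → ⟦ k ⟧ + ⟦ l ⟧ ≡ ⟦ k ℕ.+ l ⟧
    ⟦⟧-+ k l = ⟦⟧-cong (trans (cong₂ (λ u v → (u ℕ.+ v) % p) (toℕ-⟦⟧ k) (toℕ-⟦⟧ l))
                              (sym (%-distribˡ-+ k l p)))

    ⟦⟧-* : ∀ k l → ⟦ k ⟧ * ⟦ l ⟧ ≡ ⟦ k ℕ.* l ⟧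
    ⟦⟧-* k l = ⟦⟧-cong (trans (cong₂ (λ u v → (u ℕ.* v) % p) (toℕ-⟦⟧ k) (toℕ-⟦⟧ l))
                              (sym (%-distribˡ-* k l p)))

    rep : ∀ i → ∃ λ k → i ≡ ⟦ k ⟧
    rep i = toℕ i , sym (⟦⟧-toℕ i)

  +-comm : ∀ i j → i + j ≡ j + i
  +-comm i j = cong ⟦_⟧ (ℕ.+-comm (toℕ i) (toℕ j))

  *-comm : ∀ i j → i * j ≡ j * i
  *-comm i j = cong ⟦_⟧ (ℕ.*-comm (toℕ i) (toℕ j))

  +-assoc : ∀ i j k → (i + j) + k ≡ i + (j + k)
  +-assoc i j k with rep i | rep j | rep k
  ... | a , refl | b , refl | c , refl
    rewrite ⟦⟧-+ a b | ⟦⟧-+ b c | ⟦⟧-+ (a ℕ.+ b) c | ⟦⟧-+ a (b ℕ.+ c) = cong ⟦_⟧ (ℕ.+-assoc a b c)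

  *-assoc : ∀ i j k → (i * j) * k ≡ i * (j * k)
  *-assoc i j k with rep i | rep j | rep k
  ... | a , refl | b , refl | c , refl
    rewrite ⟦⟧-* a b | ⟦⟧-* b c | ⟦⟧-* (a ℕ.* b) c | ⟦⟧-* a (b ℕ.* c) = cong ⟦_⟧ (ℕ.*-assoc a b c)

  *-distribˡ-+ : ∀ i j k → i * (j + k) ≡ i * j + i * k
  *-distribˡ-+ i j k with rep i | rep j | rep k
  ... | a , refl | b , refl | c , refl
    rewrite ⟦⟧-+ b c | ⟦⟧-* a b | ⟦⟧-* a c | ⟦⟧-* a (b ℕ.+ c) | ⟦⟧-+ (a ℕ.* b) (a ℕ.* c)
    = cong ⟦_⟧ (ℕ.*-distribˡ-+ a b c)

  *-distribʳ-+ : ∀ i j k → (j + k) * i ≡ j * i + k * i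
  *-distribʳ-+ i j k = trans (*-comm (j + k) i)
    (trans (*-distribˡ-+ i j k) (cong₂ _+_ (*-comm i j) (*-comm i k)))

  +-identityˡ : ∀ i → 0# + i ≡ i
  +-identityˡ i with rep i
  ... | a , refl = ⟦⟧-+ 0 a

  +-identityʳ : ∀ i → i + 0# ≡ i
  +-identityʳ i = trans (+-comm i 0#) (+-identityˡ i)

  *-identityˡ : ∀ i → 1# * i ≡ i
  *-identityˡ i with rep i
  ... | a , refl = trans (⟦⟧-* 1 a) (cong ⟦_⟧ (ℕ.*-identityˡ a))

  *-zeroˡ : ∀ i → 0# * i ≡ 0#
  *-zeroˡ i with rep i
  ... | a , refl = ⟦⟧-* 0 a

  *-zeroʳ : ∀ i → i * 0# ≡ 0#
  *-zeroʳ i = trans (*-comm i 0#) (*-zeroˡ i)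

  +-inverseʳ : ∀ i → i + - i ≡ 0#
  +-inverseʳ i = begin
    i + - i                              ≡⟨ cong (_+ - i) (⟦⟧-toℕ i) ⟨
    ⟦ toℕ i ⟧ + - i                      ≡⟨ ⟦⟧-+ (toℕ i) (p ℕ.∸ toℕ i) ⟩
    ⟦ toℕ i ℕ.+ (p ℕ.∸ toℕ i) ⟧          ≡⟨ cong ⟦_⟧ (ℕ.m+[n∸m]≡n (ℕ.<⇒≤ (Fin.toℕ<n i))) ⟩
    ⟦ p ⟧                                ≡⟨ ⟦⟧-cong (trans (n%n≡0 p) (sym (m<n⇒m%n≡m (ℕ.>-nonZero⁻¹ p)))) ⟩
    0#                                   ∎
    where open ≡-Reasoning

  +-inverseˡ : ∀ i → - i + i ≡ 0#
  +-inverseˡ i = trans (+-comm (- i) i) (+-inverseʳ i)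

  infixl 7 _·_
  infixl 6 _⊕_
  infixr 7 _⊛_

  0ᵛ : ∀ {n} → Vec ℤₚ n
  0ᵛ = replicate _ 0#

  _⊕_ : ∀ {n} → Vec ℤₚ n → Vec ℤₚ n → Vec ℤₚ n
  _⊕_ = zipWith _+_

  ⊖_ : ∀ {n} → Vec ℤₚ n → Vec ℤₚ n
  ⊖_ = map -_

  _·_ : ∀ {n} → Vec ℤₚ n → Vec ℤₚ n → ℤₚ
  []       · []       = 0#
  (a ∷ as) · (b ∷ bs) = a * b + as · bs

  -- A matrix is a vector of rows.
  Matrix : ℕ → ℕ → Set
  Matrix m n = Vec (Vec ℤₚ n) m

  identity : ∀ n → Matrix n n
  identity zero    = []
  identity (suc n) = (1# ∷ 0ᵛ) ∷ map (0# ∷_) (identity n)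

  _⊛_ : ∀ {m n} → Matrix m n → Vec ℤₚ n → Vec ℤₚ m
  M ⊛ v = map (_· v) M

  interchange : ∀ a b c d → (a + b) + (c + d) ≡ (a + c) + (b + d)
  interchange a b c d = begin
    (a + b) + (c + d)  ≡⟨ +-assoc a b (c + d) ⟩
    a + (b + (c + d))  ≡⟨ cong (a +_) (+-assoc b c d) ⟨
    a + ((b + c) + d)  ≡⟨ cong (λ e → a + (e + d)) (+-comm b c) ⟩
    a + ((c + b) + d)  ≡⟨ cong (a +_) (+-assoc c b d) ⟩
    a + (c + (b + d))  ≡⟨ +-assoc a c (b + d) ⟨
    (a + c) + (b + d)  ∎
    where open ≡-Reasoning

  ·-distribˡ : ∀ {n} (x y z : Vec ℤₚ n) → x · (y ⊕ z) ≡ x · y + x · z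
  ·-distribˡ []       []       []       = sym (+-identityˡ 0#)
  ·-distribˡ (a ∷ as) (b ∷ bs) (c ∷ cs) =
    trans (cong₂ _+_ (*-distribˡ-+ a b c) (·-distribˡ as bs cs))
          (interchange (a * b) (a * c) (as · bs) (as · cs))

  ·-comm : ∀ {n} (x y : Vec ℤₚ n) → x · y ≡ y · x
  ·-comm []       []       = refl
  ·-comm (a ∷ as) (b ∷ bs) = cong₂ _+_ (*-comm a b) (·-comm as bs)

  ·-distribʳ : ∀ {n} (x y z : Vec ℤₚ n) → (y ⊕ z) · x ≡ y · x + z · x
  ·-distribʳ x y z = trans (·-comm (y ⊕ z) x)
    (trans (·-distribˡ x y z) (cong₂ _+_ (·-comm x y) (·-comm x z)))

  ·-zeroˡ : ∀ {n} (x : Vec ℤₚ n) → 0ᵛ · x ≡ 0#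
  ·-zeroˡ []       = refl
  ·-zeroˡ (a ∷ as) = trans (cong₂ _+_ (*-zeroˡ a) (·-zeroˡ as)) (+-identityˡ 0#)

  ·-zeroʳ : ∀ {n} (x : Vec ℤₚ n) → x · 0ᵛ ≡ 0#
  ·-zeroʳ x = trans (·-comm x 0ᵛ) (·-zeroˡ x)

  _⊙_ : ∀ {n} → Vec ℤₚ n → ℤₚ → Vec ℤₚ n
  v ⊙ t = map (_* t) v

  ·-⊙ : ∀ {n} (x y : Vec ℤₚ n) t → x · (y ⊙ t) ≡ (x · y) * t
  ·-⊙ []       []       t = sym (*-zeroˡ t)
  ·-⊙ (a ∷ as) (b ∷ bs) t =
    trans (cong₂ _+_ (sym (*-assoc a b t)) (·-⊙ as bs t))
          (sym (*-distribʳ-+ t (a * b) (as · bs)))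

  ⊙-distribʳ : ∀ {n} (x y : Vec ℤₚ n) t → (x ⊕ y) ⊙ t ≡ x ⊙ t ⊕ y ⊙ t
  ⊙-distribʳ []       []       t = refl
  ⊙-distribʳ (a ∷ as) (b ∷ bs) t = cong₂ _∷_ (*-distribʳ-+ t a b) (⊙-distribʳ as bs t)

  ⊙-zeroˡ : ∀ {n} t → 0ᵛ {n} ⊙ t ≡ 0ᵛ
  ⊙-zeroˡ {n} t = trans (Vec.map-replicate (_* t) 0# n) (cong (replicate n) (*-zeroˡ t))

  ·-∷ʳ : ∀ {n} (x y : Vec ℤₚ n) a b → (x ∷ʳ a) · (y ∷ʳ b) ≡ x · y + a * b
  ·-∷ʳ []       []       a b = trans (+-identityʳ (a * b)) (sym (+-identityˡ (a * b)))
  ·-∷ʳ (c ∷ cs) (d ∷ ds) a b =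
    trans (cong (c * d +_) (·-∷ʳ cs ds a b)) (sym (+-assoc (c * d) (cs · ds) (a * b)))

  ⊕-assoc : ∀ {n} (x y z : Vec ℤₚ n) → (x ⊕ y) ⊕ z ≡ x ⊕ (y ⊕ z)
  ⊕-assoc = Vec.zipWith-assoc +-assoc

  ⊕-comm : ∀ {n} (x y : Vec ℤₚ n) → x ⊕ y ≡ y ⊕ x
  ⊕-comm = Vec.zipWith-comm +-comm

  ⊕-identityˡ : ∀ {n} (x : Vec ℤₚ n) → 0ᵛ ⊕ x ≡ x
  ⊕-identityˡ = Vec.zipWith-identityˡ +-identityˡ

  ⊕-identityʳ : ∀ {n} (x : Vec ℤₚ n) → x ⊕ 0ᵛ ≡ x
  ⊕-identityʳ = Vec.zipWith-identityʳ +-identityʳ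

  ⊕-inverseˡ : ∀ {n} (x : Vec ℤₚ n) → ⊖ x ⊕ x ≡ 0ᵛ
  ⊕-inverseˡ = Vec.zipWith-inverseˡ +-inverseˡ

  ⊕-inverseʳ : ∀ {n} (x : Vec ℤₚ n) → x ⊕ ⊖ x ≡ 0ᵛ
  ⊕-inverseʳ = Vec.zipWith-inverseʳ +-inverseʳ

module Heisenberg (p : ℕ) {{_ : NonZero p}} (n : ℕ) where
  open Modular p

  -- The triple (x , y , z) stands for the matrix with first row (1 , x , z)
  -- and last column (z , y , 1).
  G : Set
  G = Vec ℤₚ n × Vec ℤₚ n × ℤₚ

  matrix : G → Matrix (2 ℕ.+ n) (2 ℕ.+ n)
  matrix (x , y , z) =
      (1# ∷ (x ∷ʳ z))
    ∷ (zipWith (λ e yᵢ → 0# ∷ (e ∷ʳ yᵢ)) (identity n) y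
    ∷ʳ (0# ∷ (0ᵛ ∷ʳ 1#)))

  X : Set
  X = Vec ℤₚ (2 ℕ.+ n)

  infixr 6 _▷_
  infixl 7 _∙_

  _▷_ : G → X → X
  a ▷ v = matrix a ⊛ v

  -- The product of matrices in coordinates: by ∙▷ below, matrix (a ∙ b) acts
  -- on every vector as the composite of matrix a and matrix b.
  _∙_ : G → G → G
  (x , y , z) ∙ (x′ , y′ , z′) = x ⊕ x′ , y ⊕ y′ , z + z′ + x · y′

  ε : G
  ε = 0ᵛ , 0ᵛ , 0#

  _⁻¹ : G → G
  (x , y , z) ⁻¹ = ⊖ x , ⊖ y , - z + x · y

  Centre : Pred G 0ℓ
  Centre (x , y , z) = x ≡ 0ᵛ × y ≡ 0ᵛ

  private
    triple : ∀ {x x′ y y′ : Vec ℤₚ n} {z z′ : ℤₚ} → x ≡ x′ → y ≡ y′ → z ≡ z′ →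
             _≡_ {A = G} (x , y , z) (x′ , y′ , z′)
    triple refl refl refl = refl

    swap-last : ∀ a b c → (a + b) + c ≡ (a + c) + b
    swap-last a b c = trans (+-assoc a b c)
      (trans (cong (a +_) (+-comm b c)) (sym (+-assoc a c b)))

  ∙-assoc : ∀ a b c → (a ∙ b) ∙ c ≡ a ∙ (b ∙ c)
  ∙-assoc (x₁ , y₁ , z₁) (x₂ , y₂ , z₂) (x₃ , y₃ , z₃) =
    triple (⊕-assoc x₁ x₂ x₃) (⊕-assoc y₁ y₂ y₃) (begin
      z₁ + z₂ + x₁ · y₂ + z₃ + (x₁ ⊕ x₂) · y₃
        ≡⟨ cong₂ _+_ (swap-last (z₁ + z₂) (x₁ · y₂) z₃) (trans (·-distribʳ y₃ x₁ x₂) (+-comm (x₁ · y₃) (x₂ · y₃))) ⟩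
      z₁ + z₂ + z₃ + x₁ · y₂ + (x₂ · y₃ + x₁ · y₃)
        ≡⟨ interchange (z₁ + z₂ + z₃) (x₁ · y₂) (x₂ · y₃) (x₁ · y₃) ⟩
      z₁ + z₂ + z₃ + x₂ · y₃ + (x₁ · y₂ + x₁ · y₃)
        ≡⟨ cong₂ _+_ (trans (cong (_+ x₂ · y₃) (+-assoc z₁ z₂ z₃)) (+-assoc z₁ (z₂ + z₃) (x₂ · y₃))) (sym (·-distribˡ x₁ y₂ y₃)) ⟩
      z₁ + (z₂ + z₃ + x₂ · y₃) + x₁ · (y₂ ⊕ y₃) ∎)
    where open ≡-Reasoning

  ∙-identityˡ : ∀ a → ε ∙ a ≡ a
  ∙-identityˡ (x , y , z) = triple (⊕-identityˡ x) (⊕-identityˡ y)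
    (trans (cong₂ _+_ (+-identityˡ z) (·-zeroˡ y)) (+-identityʳ z))

  ∙-identityʳ : ∀ a → a ∙ ε ≡ a
  ∙-identityʳ (x , y , z) = triple (⊕-identityʳ x) (⊕-identityʳ y)
    (trans (cong₂ _+_ (+-identityʳ z) (·-zeroʳ x)) (+-identityʳ z))

  ∙-inverseˡ : ∀ a → a ⁻¹ ∙ a ≡ ε
  ∙-inverseˡ (x , y , z) = triple (⊕-inverseˡ x) (⊕-inverseˡ y) (begin
    - z + x · y + z + (⊖ x) · y   ≡⟨ cong (_+ (⊖ x) · y) (swap-last (- z) (x · y) z) ⟩
    - z + z + x · y + (⊖ x) · y   ≡⟨ cong (λ k → k + x · y + (⊖ x) · y) (+-inverseˡ z) ⟩
    0# + x · y + (⊖ x) · y        ≡⟨ cong (_+ (⊖ x) · y) (+-identityˡ (x · y)) ⟩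
    x · y + (⊖ x) · y             ≡⟨ ·-distribʳ y x (⊖ x) ⟨
    (x ⊕ ⊖ x) · y                 ≡⟨ cong (_· y) (⊕-inverseʳ x) ⟩
    0ᵛ · y                        ≡⟨ ·-zeroˡ y ⟩
    0#                            ∎)
    where open ≡-Reasoning

  ∙-inverseʳ : ∀ a → a ∙ a ⁻¹ ≡ ε
  ∙-inverseʳ (x , y , z) = triple (⊕-inverseʳ x) (⊕-inverseʳ y) (begin
    z + (- z + x · y) + x · (⊖ y)   ≡⟨ cong (_+ x · (⊖ y)) (+-assoc z (- z) (x · y)) ⟨
    z + - z + x · y + x · (⊖ y)     ≡⟨ cong (λ k → k + x · y + x · (⊖ y)) (+-inverseʳ z) ⟩
    0# + x · y + x · (⊖ y)          ≡⟨ cong (_+ x · (⊖ y)) (+-identityˡ (x · y)) ⟩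
    x · y + x · (⊖ y)               ≡⟨ ·-distribˡ x y (⊖ y) ⟨
    x · (y ⊕ ⊖ y)                   ≡⟨ cong (x ·_) (⊕-inverseʳ y) ⟩
    x · 0ᵛ                          ≡⟨ ·-zeroʳ x ⟩
    0#                              ∎)
    where open ≡-Reasoning

  isGroup : IsGroup _≡_ _∙_ ε _⁻¹
  isGroup = record
    { isMonoid = record
      { isSemigroup = record
        { isMagma = record { isEquivalence = isEquivalence ; ∙-cong = cong₂ _∙_ }
        ; assoc   = ∙-assoc
        }
      ; identity = ∙-identityˡ , ∙-identityʳ
      }
    ; inverse = ∙-inverseˡ , ∙-inverseʳ
    ; ⁻¹-cong = cong _⁻¹
    }

  finℤₚ : Finite ℤₚ
  finℤₚ = finFin p

  finG : Finite G
  finG = finVec finℤₚ n ×ᶠ finVec finℤₚ n ×ᶠ finℤₚ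

  Centre? : Decidable Centre
  Centre? (x , y , z) = x ≟ᵛ 0ᵛ ×-dec y ≟ᵛ 0ᵛ
    where open Finite (finVec finℤₚ n) renaming (_≟_ to _≟ᵛ_)

  Centre-∙ : ∀ {a b} → Centre a → Centre b → Centre (a ∙ b)
  Centre-∙ (refl , refl) (refl , refl) = ⊕-identityˡ 0ᵛ , ⊕-identityˡ 0ᵛ

  Centre-⁻¹ : ∀ {a} → Centre a → Centre (a ⁻¹)
  Centre-⁻¹ (refl , refl) = ⊖0ᵛ , ⊖0ᵛ
    where
    ⊖0ᵛ : ⊖ 0ᵛ ≡ 0ᵛ
    ⊖0ᵛ = trans (sym (⊕-identityʳ (⊖ 0ᵛ))) (⊕-inverseˡ 0ᵛ)

  private
    middle : ∀ {m} (M : Matrix m n) (y : Vec ℤₚ m) u w t →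
      zipWith (λ e yᵢ → 0# ∷ (e ∷ʳ yᵢ)) M y ⊛ (u ∷ (w ∷ʳ t)) ≡ M ⊛ w ⊕ y ⊙ t
    middle []      []       u w t = refl
    middle (e ∷ M) (yᵢ ∷ y) u w t = cong₂ _∷_
      (trans (cong₂ _+_ (*-zeroˡ u) (·-∷ʳ e w yᵢ t)) (+-identityˡ _))
      (middle M y u w t)

    0∷-⊛ : ∀ {m k} (M : Matrix m k) a v → map (0# ∷_) M ⊛ (a ∷ v) ≡ M ⊛ v
    0∷-⊛ []      a v = refl
    0∷-⊛ (e ∷ M) a v = cong₂ _∷_
      (trans (cong (_+ e · v) (*-zeroˡ a)) (+-identityˡ (e · v))) (0∷-⊛ M a v)

    identity-⊛ : ∀ {m} (v : Vec ℤₚ m) → identity m ⊛ v ≡ v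
    identity-⊛ []      = refl
    identity-⊛ (a ∷ v) = cong₂ _∷_
      (trans (cong₂ _+_ (*-identityˡ a) (·-zeroˡ v)) (+-identityʳ a))
      (trans (0∷-⊛ (identity _) a v) (identity-⊛ v))

  ▷-formula : ∀ x y z u w t →
    (x , y , z) ▷ (u ∷ (w ∷ʳ t)) ≡ (u + (x · w + z * t)) ∷ ((w ⊕ y ⊙ t) ∷ʳ t)
  ▷-formula x y z u w t = cong₂ _∷_
    (cong₂ _+_ (*-identityˡ u) (·-∷ʳ x w z t))
    (trans (Vec.map-∷ʳ (_· (u ∷ (w ∷ʳ t))) _ (zipWith (λ e yᵢ → 0# ∷ (e ∷ʳ yᵢ)) (identity n) y))
      (cong₂ _∷ʳ_
        (trans (middle (identity n) y u w t) (cong (_⊕ y ⊙ t) (identity-⊛ w)))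
        (trans (cong₂ _+_ (*-zeroˡ u) (·-∷ʳ 0ᵛ w 1# t))
          (trans (+-identityˡ _)
            (trans (cong₂ _+_ (·-zeroˡ w) (*-identityˡ t)) (+-identityˡ t))))))

  ε▷ : ∀ v → ε ▷ v ≡ v
  ε▷ (u ∷ v) with initLast v
  ... | w , t , refl = trans (▷-formula 0ᵛ 0ᵛ 0# u w t) (cong₂ _∷_
    (trans (cong (u +_) (trans (cong₂ _+_ (·-zeroˡ w) (*-zeroˡ t)) (+-identityˡ 0#))) (+-identityʳ u))
    (cong (_∷ʳ t) (trans (cong (w ⊕_) (⊙-zeroˡ t)) (⊕-identityʳ w))))

  ∙▷ : ∀ a b v → (a ∙ b) ▷ v ≡ a ▷ (b ▷ v)
  ∙▷ a@(x , y , z) b@(x′ , y′ , z′) (u ∷ v) with initLast v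
  ... | w , t , refl = begin
    (a ∙ b) ▷ (u ∷ (w ∷ʳ t))
      ≡⟨ ▷-formula (x ⊕ x′) (y ⊕ y′) (z + z′ + x · y′) u w t ⟩
    (u + ((x ⊕ x′) · w + (z + z′ + x · y′) * t)) ∷ ((w ⊕ (y ⊕ y′) ⊙ t) ∷ʳ t)
      ≡⟨ cong₂ _∷_ first (cong (_∷ʳ t) rest) ⟩
    (u + (x′ · w + z′ * t) + (x · (w ⊕ y′ ⊙ t) + z * t)) ∷ ((w ⊕ y′ ⊙ t ⊕ y ⊙ t) ∷ʳ t)
      ≡⟨ ▷-formula x y z (u + (x′ · w + z′ * t)) (w ⊕ y′ ⊙ t) t ⟨
    a ▷ ((u + (x′ · w + z′ * t)) ∷ ((w ⊕ y′ ⊙ t) ∷ʳ t))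
      ≡⟨ cong (a ▷_) (▷-formula x′ y′ z′ u w t) ⟨
    a ▷ (b ▷ (u ∷ (w ∷ʳ t))) ∎
    where
    open ≡-Reasoning

    rest : w ⊕ (y ⊕ y′) ⊙ t ≡ w ⊕ y′ ⊙ t ⊕ y ⊙ t
    rest = trans (cong (w ⊕_) (trans (⊙-distribʳ y y′ t) (⊕-comm (y ⊙ t) (y′ ⊙ t))))
                 (sym (⊕-assoc w (y′ ⊙ t) (y ⊙ t)))

    first : u + ((x ⊕ x′) · w + (z + z′ + x · y′) * t)
          ≡ u + (x′ · w + z′ * t) + (x · (w ⊕ y′ ⊙ t) + z * t)
    first = trans (cong (u +_) (begin
      (x ⊕ x′) · w + (z + z′ + x · y′) * t
        ≡⟨ cong₂ _+_ (trans (·-distribʳ w x x′) (+-comm (x · w) (x′ · w)))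
                     (trans (cong (_* t) (trans (+-assoc z z′ (x · y′)) (+-comm z (z′ + x · y′))))
                       (trans (*-distribʳ-+ t (z′ + x · y′) z)
                         (cong (_+ z * t) (*-distribʳ-+ t z′ (x · y′))))) ⟩
      (x′ · w + x · w) + ((z′ * t + (x · y′) * t) + z * t)
        ≡⟨ cong ((x′ · w + x · w) +_) (+-assoc (z′ * t) ((x · y′) * t) (z * t)) ⟩
      (x′ · w + x · w) + (z′ * t + ((x · y′) * t + z * t))
        ≡⟨ interchange (x′ · w) (x · w) (z′ * t) ((x · y′) * t + z * t) ⟩
      (x′ · w + z′ * t) + (x · w + ((x · y′) * t + z * t))
        ≡⟨ cong ((x′ · w + z′ * t) +_) (+-assoc (x · w) ((x · y′) * t) (z * t)) ⟨
      (x′ · w + z′ * t) + ((x · w + (x · y′) * t) + z * t)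
        ≡⟨ cong (λ k → (x′ · w + z′ * t) + (k + z * t))
             (trans (cong (x · w +_) (sym (·-⊙ x y′ t))) (sym (·-distribˡ x w (y′ ⊙ t)))) ⟩
      (x′ · w + z′ * t) + (x · (w ⊕ y′ ⊙ t) + z * t) ∎))
      (sym (+-assoc u _ _))

heisenbergProblem : (p : ℕ) {{_ : NonZero p}} (n : ℕ) → CosetProblem
heisenbergProblem p n = record
  { isGroup = isGroup
  ; finG    = finG
  ; H       = Centre
  ; H?      = Centre?
  ; ε∈H     = refl , refl
  ; ∙∈H     = λ {a} {b} → Centre-∙ {a} {b}
  ; ⁻¹∈H    = λ {a} → Centre-⁻¹ {a}
  ; finX    = finVec finℤₚ (2 ℕ.+ n)
  ; _▷_     = _▷_
  ; ε▷      = ε▷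
  ; ∙▷      = ∙▷
  }
  where open Heisenberg p n

{-# OPTIONS --safe #-}
module Submission where

-- Let W = ℤₚⁿ.  A query to (x , y , z) turns |u , w , 1⟩ ⊗ |w⟩ into
-- |u + x·w + z , w + y , 1⟩ ⊗ |w⟩.  The difference of the two W-registers is y,
-- and s = (first register) − x·(second register) is u + z − x·y, whatever w is.
-- Hence, in the Fourier basis of the first register, ∑_w turns into a
-- generalised Bell state which determines x and y, except under the trivial
-- character of ℤₚ, which does not see x; starting from |0⟩ − |1⟩ in place of |u⟩
-- avoids that character.
--
-- Adding up the Bell projections over all nontrivial characters removes the
-- roots of unity.  The effect of (x , y) is, on the span of the basis vectors
-- whose W-registers differ by y and with the identity on the other registers,
--   |W|⁻¹ (([s = s′] − 1/p) + 1/p [w = w′]),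
-- where the last term only completes the measurement on the trivial character.
-- The effects sum to the identity because u − x·w = u′ − x·w′ has |W|/p
-- solutions x if w ≠ w′; this is where p has to be prime.  A further register
-- with 2|W| basis states makes the norm of the initial state rational.

import Algebra.Properties.AbelianGroup as AbelianGroupProperties
open import Algebra.Bundles using (AbelianGroup)
open import Data.Bool.Base using (if_then_else_)
open import Data.Empty using (⊥-elim)
open import Data.Fin.Base as Fin using (Fin; toℕ)
import Data.Fin.Properties as Fin
import Data.Integer.Base as ℤ
import Data.Integer.Properties as ℤ
open import Data.List.Base
  using (List; []; _∷_; _++_; map; length; lookup; allFin; cartesianProductWith)
import Data.List.Properties as List
open import Data.List.Membership.Propositional using (_∈_)
import Data.List.Membership.Propositional.Properties as Membership
open import Data.List.Relation.Unary.All as All using (All; []; _∷_)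
open import Data.List.Relation.Unary.AllPairs as AllPairs using ([]; _∷_)
import Data.List.Relation.Unary.AllPairs.Properties as AllPairs
open import Data.List.Relation.Unary.Any as Any using (here; there)
import Data.List.Relation.Unary.Any.Properties as Any
open import Data.List.Relation.Unary.Unique.DecSetoid.Properties using (deduplicate-!)
open import Data.List.Relation.Unary.Unique.Propositional using (Unique)
open import Data.Nat.Base as ℕ using (ℕ; zero; suc; _≥_)
open import Data.Nat.Coprimality using (prime⇒coprime; coprime-Bézout)
open import Data.Nat.DivMod
  using (_%_; _mod_; m%n<n; m<n⇒m%n≡m; m%n%n≡m%n; [m+kn]%n≡m%n; %-distribˡ-*)
open import Data.Nat.GCD using (module Bézout)
open import Data.Nat.Primality using (Prime; prime⇒nonZero; prime⇒nonTrivial)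
import Data.Nat.Properties as ℕ
import Data.Nat.Solver as ℕ
open import Data.Product.Base using (_×_; _,_; proj₁; proj₂; ∃)
open import Data.Rational.Base hiding (_≥_)
open import Data.Rational.Properties hiding (_≟_)
open import Data.Rational.Solver using (module +-*-Solver)
import Data.Rational.Unnormalised.Base as ℚᵘ
import Data.Rational.Unnormalised.Properties as ℚᵘ
open import Data.Sum.Base using (inj₁; inj₂)
open import Data.Vec.Base using (Vec; []; _∷_; _∷ʳ_; head; tail; init; last; initLast)
import Data.Vec.Properties as Vec
open import Function.Base using (_∘_; id)
open import Level using (0ℓ)
open import Relation.Binary.Bundles using (DecSetoid)
open import Relation.Binary.PropositionalEquality
open import Relation.Nullary using (Dec; yes; no; does; ¬_)
open import Defs

open Finite hiding (∣_∣)
open ≡-Reasoning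

-- Finite sums of rationals

sum : ∀ {A : Set} → List A → (A → ℚ) → ℚ
sum []       f = 0ℚ
sum (a ∷ as) f = f a + sum as f

module _ {A : Set} where

  sum-cong : ∀ (as : List A) {f g : A → ℚ} → (∀ a → f a ≡ g a) → sum as f ≡ sum as g
  sum-cong []       f≗g = refl
  sum-cong (a ∷ as) f≗g = cong₂ _+_ (f≗g a) (sum-cong as f≗g)

  sum-zero : ∀ (as : List A) → sum as (λ _ → 0ℚ) ≡ 0ℚ
  sum-zero []       = refl
  sum-zero (a ∷ as) = trans (+-identityˡ _) (sum-zero as)

  sum-distrib-+ : ∀ (as : List A) (f g : A → ℚ) →
    sum as (λ a → f a + g a) ≡ sum as f + sum as g
  sum-distrib-+ []       f g = refl
  sum-distrib-+ (a ∷ as) f g = trans (cong (f a + g a +_) (sum-distrib-+ as f g))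
    (solve 4 (λ b c s t → (b :+ c) :+ (s :+ t) := (b :+ s) :+ (c :+ t)) refl
      (f a) (g a) (sum as f) (sum as g))
    where open +-*-Solver

  *-distribˡ-sum : ∀ c (as : List A) (f : A → ℚ) → c * sum as f ≡ sum as (λ a → c * f a)
  *-distribˡ-sum c []       f = *-zeroʳ c
  *-distribˡ-sum c (a ∷ as) f =
    trans (*-distribˡ-+ c (f a) (sum as f)) (cong (c * f a +_) (*-distribˡ-sum c as f))

  *-distribʳ-sum : ∀ c (as : List A) (f : A → ℚ) → sum as f * c ≡ sum as (λ a → f a * c)
  *-distribʳ-sum c as f = begin
    sum as f * c             ≡⟨ *-comm (sum as f) c ⟩
    c * sum as f             ≡⟨ *-distribˡ-sum c as f ⟩
    sum as (λ a → c * f a)   ≡⟨ sum-cong as (λ a → *-comm c (f a)) ⟩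
    sum as (λ a → f a * c)   ∎

  sum-const : ∀ c (as : List A) → sum as (λ _ → c) ≡ c * sum as (λ _ → 1ℚ)
  sum-const c as = trans (sum-cong as (λ _ → sym (*-identityʳ c))) (sym (*-distribˡ-sum c as _))

  sum-distrib-- : ∀ (as : List A) (f g : A → ℚ) →
    sum as (λ a → f a - g a) ≡ sum as f - sum as g
  sum-distrib-- as f g = trans (sum-distrib-+ as f (λ a → - g a)) (cong (sum as f +_) (begin
    sum as (λ a → - g a)         ≡⟨ sum-cong as (λ a → trans (cong -_ (sym (*-identityˡ (g a)))) (neg-distribˡ-* 1ℚ (g a))) ⟩
    sum as (λ a → - 1ℚ * g a)    ≡⟨ *-distribˡ-sum (- 1ℚ) as g ⟨
    - 1ℚ * sum as g              ≡⟨ neg-distribˡ-* 1ℚ (sum as g) ⟨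
    - (1ℚ * sum as g)            ≡⟨ cong -_ (*-identityˡ _) ⟩
    - sum as g                   ∎))

  sum-++ : ∀ (as bs : List A) (f : A → ℚ) → sum (as ++ bs) f ≡ sum as f + sum bs f
  sum-++ []       bs f = sym (+-identityˡ _)
  sum-++ (a ∷ as) bs f = trans (cong (f a +_) (sum-++ as bs f)) (sym (+-assoc (f a) _ _))

  sum-nonNeg : ∀ (as : List A) {f : A → ℚ} → (∀ a → 0ℚ ≤ f a) → 0ℚ ≤ sum as f
  sum-nonNeg []       0≤f = ≤-refl
  sum-nonNeg (a ∷ as) 0≤f = +-mono-≤ (0≤f a) (sum-nonNeg as 0≤f)

  sum-1-nonNeg : ∀ (as : List A) → 0ℚ ≤ sum as (λ _ → 1ℚ)
  sum-1-nonNeg as = sum-nonNeg as (λ _ → nonNegative⁻¹ 1ℚ)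

  sum-1-positive : ∀ {a} {as : List A} → a ∈ as → 0ℚ < sum as (λ _ → 1ℚ)
  sum-1-positive {as = b ∷ as} _ = +-mono-<-≤ (positive⁻¹ 1ℚ) (sum-1-nonNeg as)

sum-map : ∀ {A B : Set} (h : A → B) as (f : B → ℚ) → sum (map h as) f ≡ sum as (f ∘ h)
sum-map h []       f = refl
sum-map h (a ∷ as) f = cong (f (h a) +_) (sum-map h as f)

module _ {A B : Set} where

  sum-comm : ∀ (as : List A) (bs : List B) (f : A → B → ℚ) →
    sum as (λ a → sum bs (f a)) ≡ sum bs (λ b → sum as (λ a → f a b))
  sum-comm []       bs f = sym (sum-zero bs)
  sum-comm (a ∷ as) bs f = trans (cong (sum bs (f a) +_) (sum-comm as bs f))
    (sym (sum-distrib-+ bs (f a) _))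

  sum-cartesianProductWith : ∀ {C : Set} (h : A → B → C) as bs (f : C → ℚ) →
    sum (cartesianProductWith h as bs) f ≡ sum as (λ a → sum bs (λ b → f (h a b)))
  sum-cartesianProductWith h []       bs f = refl
  sum-cartesianProductWith h (a ∷ as) bs f = trans (sum-++ (map (h a) bs) _ f)
    (cong₂ _+_ (sum-map (h a) bs f) (sum-cartesianProductWith h as bs f))

-- Turns a sum over the ancilla, whose basis is a `Fin`, into a sum over the labels that its basis
-- states carry.
sum-lookup : ∀ {A : Set} (as : List A) (f : A → ℚ) →
  sum (allFin (length as)) (f ∘ lookup as) ≡ sum as f
sum-lookup as f = trans (sym (sum-map (lookup as) (allFin (length as)) f))
  (cong (λ bs → sum bs f) (trans (List.map-tabulate id (lookup as)) (List.tabulate-lookup as)))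

-- Indicators, Kronecker deltas and sums over finite types

𝟙 : ∀ {P : Set} → Dec P → ℚ
𝟙 P? = if does P? then 1ℚ else 0ℚ

module _ {P : Set} where

  𝟙-true : (P? : Dec P) → P → 𝟙 P? ≡ 1ℚ
  𝟙-true (yes _) _ = refl
  𝟙-true (no ¬p) p = ⊥-elim (¬p p)

  𝟙-false : (P? : Dec P) → ¬ P → 𝟙 P? ≡ 0ℚ
  𝟙-false (yes p) ¬p = ⊥-elim (¬p p)
  𝟙-false (no _)  _  = refl

𝟙-cong : ∀ {P Q : Set} (P? : Dec P) (Q? : Dec Q) → (P → Q) → (Q → P) → 𝟙 P? ≡ 𝟙 Q?
𝟙-cong (yes p) Q? to from = sym (𝟙-true Q? (to p))
𝟙-cong (no ¬p) Q? to from = sym (𝟙-false Q? (¬p ∘ from))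

𝟙-* : ∀ {P Q R : Set} (P? : Dec P) (Q? : Dec Q) (R? : Dec R) →
  (P → Q → R) → (R → P × Q) → 𝟙 P? * 𝟙 Q? ≡ 𝟙 R?
𝟙-* (yes p) Q? R? to from = trans (*-identityˡ _) (𝟙-cong Q? R? (to p) (proj₂ ∘ from))
𝟙-* (no ¬p) Q? R? to from = trans (*-zeroˡ (𝟙 Q?)) (sym (𝟙-false R? (¬p ∘ proj₁ ∘ from)))

module _ {A : Set} where

  sum-𝟙-absent : ∀ (_≟_ : (a b : A) → Dec (a ≡ b)) {a as} (f : A → ℚ) →
    All (λ b → ¬ a ≡ b) as → sum as (λ b → 𝟙 (a ≟ b) * f b) ≡ 0ℚ
  sum-𝟙-absent _≟_ f []                = refl
  sum-𝟙-absent _≟_ {a} {b ∷ as} f (a≢b ∷ a∉as) = begin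
    𝟙 (a ≟ b) * f b + sum as (λ b → 𝟙 (a ≟ b) * f b)
      ≡⟨ cong₂ _+_ (trans (cong (_* f b) (𝟙-false (a ≟ b) a≢b)) (*-zeroˡ (f b))) (sum-𝟙-absent _≟_ f a∉as) ⟩
    0ℚ + 0ℚ ≡⟨⟩
    0ℚ ∎

  sum-𝟙 : ∀ (_≟_ : (a b : A) → Dec (a ≡ b)) {a as} (f : A → ℚ) →
    Unique as → a ∈ as → sum as (λ b → 𝟙 (a ≟ b) * f b) ≡ f a
  sum-𝟙 _≟_ {a} {_ ∷ as} f (a∉as ∷ _) (here refl) = begin
    𝟙 (a ≟ a) * f a + sum as (λ b → 𝟙 (a ≟ b) * f b)
      ≡⟨ cong₂ _+_ (trans (cong (_* f a) (𝟙-true (a ≟ a) refl)) (*-identityˡ (f a))) (sum-𝟙-absent _≟_ f a∉as) ⟩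
    f a + 0ℚ ≡⟨ +-identityʳ (f a) ⟩
    f a ∎
  sum-𝟙 _≟_ {a} {b ∷ as} f (b∉as ∷ as!) (there a∈as) = begin
    𝟙 (a ≟ b) * f b + sum as (λ b → 𝟙 (a ≟ b) * f b)
      ≡⟨ cong₂ _+_ (trans (cong (_* f b) (𝟙-false (a ≟ b) λ { refl → All.lookup b∉as a∈as refl })) (*-zeroˡ (f b))) (sum-𝟙 _≟_ f as! a∈as) ⟩
    0ℚ + f a ≡⟨ +-identityˡ (f a) ⟩
    f a ∎

∑ : ∀ {A : Set} → Finite A → (A → ℚ) → ℚ
∑ α = sum (elements α)

card : ∀ {A : Set} → Finite A → ℚ
card α = ∑ α λ _ → 1ℚ

module _ {A : Set} (α : Finite A) where

  δ : A → A → ℚ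
  δ a b = 𝟙 (_≟_ α a b)

  δ-refl : ∀ a → δ a a ≡ 1ℚ
  δ-refl a = 𝟙-true (_≟_ α a a) refl

  δ-sym : ∀ a b → δ a b ≡ δ b a
  δ-sym a b = 𝟙-cong (_≟_ α a b) (_≟_ α b a) sym sym

  ∑-δˡ : ∀ a (f : A → ℚ) → ∑ α (λ b → δ a b * f b) ≡ f a
  ∑-δˡ a f = sum-𝟙 (_≟_ α) f (unique α) (complete α a)

  ∑-δʳ : ∀ a (f : A → ℚ) → ∑ α (λ b → f b * δ a b) ≡ f a
  ∑-δʳ a f = trans (sum-cong (elements α) λ b → *-comm (f b) (δ a b)) (∑-δˡ a f)

  ∑-δδ : ∀ a b → ∑ α (λ c → δ a c * δ b c) ≡ δ a b
  ∑-δδ a b = trans (∑-δˡ a (δ b)) (δ-sym b a)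

  ∑-δ : ∀ a → ∑ α (δ a) ≡ 1ℚ
  ∑-δ a = trans (sum-cong (elements α) λ b → sym (*-identityʳ (δ a b))) (∑-δˡ a λ _ → 1ℚ)

  -- The inhabitant rules out cardinality zero. Nonnegativity comes along because the inverse will
  -- scale positive semidefinite matrices.
  card-inverse : A → ∃ λ r → 0ℚ ≤ r × card α * r ≡ 1ℚ
  card-inverse a = 1/ card α , <⇒≤ (positive⁻¹ (1/ card α) {{1/pos⇒pos (card α)}}) , *-inverseʳ (card α)
    where
    instance
      card>0 : Positive (card α)
      card>0 = positive (sum-1-positive (complete α a))
      card≢0 : NonZero (card α)
      card≢0 = pos⇒nonZero (card α)

-- Inserting `δ β` writes each `f a` as a sum over `β`; after exchanging the sums, the sum over `α`
-- collapses. This is how a sum over a transversal becomes a sum over all pairs (x , y).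
∑-unique : ∀ {A : Set} (α β : Finite A) (f : A → ℚ) → ∑ α f ≡ ∑ β f
∑-unique α β f = begin
  ∑ α f                                     ≡⟨ sum-cong (elements α) (λ a → sym (∑-δˡ β a f)) ⟩
  ∑ α (λ a → ∑ β λ b → δ β a b * f b)       ≡⟨ sum-comm (elements α) (elements β) _ ⟩
  ∑ β (λ b → ∑ α λ a → δ β a b * f b)
    ≡⟨ sum-cong (elements β) (λ b → trans
         (sum-cong (elements α) λ a → trans (*-comm (δ β a b) (f b)) (cong (f b *_) (𝟙-cong (_≟_ β a b) (_≟_ α b a) sym sym)))
         (trans (sym (*-distribˡ-sum (f b) (elements α) (δ α b)))
           (trans (cong (f b *_) (∑-δ α b)) (*-identityʳ (f b))))) ⟩
  ∑ β f                                     ∎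

module _ {A B : Set} (α : Finite A) (β : Finite B) where

  ∑-× : ∀ (f : A × B → ℚ) → ∑ (α ×ᶠ β) f ≡ ∑ α λ a → ∑ β λ b → f (a , b)
  ∑-× = sum-cartesianProductWith _,_ (elements α) (elements β)

  δ-× : ∀ a b a′ b′ → δ α a a′ * δ β b b′ ≡ δ (α ×ᶠ β) (a , b) (a′ , b′)
  δ-× a b a′ b′ = 𝟙-* (_≟_ α a a′) (_≟_ β b b′) (_≟_ (α ×ᶠ β) (a , b) (a′ , b′))
    (λ { refl refl → refl }) (λ { refl → refl , refl })

  card-× : card (α ×ᶠ β) ≡ card α * card β
  card-× = trans (∑-× _) (trans (sum-const (card β) (elements α)) (*-comm (card β) _))

∑-∷ : ∀ {A : Set} (α : Finite A) n (f : Vec A (suc n) → ℚ) →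
  ∑ (finVec α (suc n)) f ≡ ∑ α λ a → ∑ (finVec α n) λ as → f (a ∷ as)
∑-∷ α n = sum-cartesianProductWith _∷_ (elements α) (elements (finVec α n))

card-∷ : ∀ {A : Set} (α : Finite A) n → card (finVec α (suc n)) ≡ card α * card (finVec α n)
card-∷ α n = trans (∑-∷ α n _) (trans (sum-const (card (finVec α n)) (elements α)) (*-comm (card (finVec α n)) (card α)))

-- Complex numbers with constant rational terms

infix 4 _↝_

-- All amplitudes and matrix entries of the algorithm are rational, and the operations on `ℂ` act
-- term by term. Equality of every term therefore reduces complex identities to rational ones
-- without estimates.
record _↝_ (z : ℂ) (q : ℚ) : Set where
  constructor _,_
  field
    re↝ : ∀ k → seq (re z) k ≡ q
    im↝ : ∀ k → seq (im z) k ≡ 0ℚ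

open _↝_

↝-ℚ : ∀ q → ℚ→ℂ q ↝ q
↝-ℚ q = (λ _ → refl) , λ _ → refl

↝-subst : ∀ {z q r} → z ↝ q → q ≡ r → z ↝ r
↝-subst z↝q refl = z↝q

↝-+ : ∀ {w z q r} → w ↝ q → z ↝ r → w +ᶜ z ↝ q + r
↝-+ w↝q z↝r = (λ k → cong₂ _+_ (re↝ w↝q k) (re↝ z↝r k)) , λ k → cong₂ _+_ (im↝ w↝q k) (im↝ z↝r k)

↝-* : ∀ {w z q r} → w ↝ q → z ↝ r → w *ᶜ z ↝ q * r
↝-* {q = q} {r} w↝q z↝r =
    (λ k → trans (cong₂ _-_ (cong₂ _*_ (re↝ w↝q k) (re↝ z↝r k)) (cong₂ _*_ (im↝ w↝q k) (im↝ z↝r k)))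
      (+-identityʳ (q * r)))
  , (λ k → trans (cong₂ _+_ (cong₂ _*_ (re↝ w↝q k) (im↝ z↝r k)) (cong₂ _*_ (im↝ w↝q k) (re↝ z↝r k)))
      (cong₂ _+_ (*-zeroʳ q) (*-zeroˡ r)))

↝-conj : ∀ {z q} → z ↝ q → conj z ↝ q
↝-conj z↝q = re↝ z↝q , λ k → cong -_ (im↝ z↝q k)

↝-𝟙 : ∀ {P : Set} (P? : Dec P) → (if does P? then 1ᶜ else 0ᶜ) ↝ 𝟙 P?
↝-𝟙 (yes _) = ↝-ℚ 1ℚ
↝-𝟙 (no _)  = ↝-ℚ 0ℚ

↝-sum : ∀ {A : Set} (as : List A) {f : A → ℂ} {g : A → ℚ} → (∀ a → f a ↝ g a) → sumList as f ↝ sum as g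
↝-sum []       f↝g = ↝-ℚ 0ℚ
↝-sum (a ∷ as) f↝g = ↝-+ (f↝g a) (↝-sum as f↝g)

≈ᴿ-pointwise : ∀ {x y} → (∀ k → seq x k ≡ seq y k) → x ≈ᴿ y
≈ᴿ-pointwise {x} {y} x≗y ε 0<ε = 0 , λ k _ → subst (λ q → ∣ q ∣ < ε)
  (sym (trans (cong (_- seq y k) (x≗y k)) (+-inverseʳ (seq y k)))) 0<ε

↝⇒≈ᶜ : ∀ {w z q} → w ↝ q → z ↝ q → w ≈ᶜ z
↝⇒≈ᶜ {w} {z} w↝q z↝q =
    ≈ᴿ-pointwise {re w} {re z} (λ k → trans (re↝ w↝q k) (sym (re↝ z↝q k)))
  , ≈ᴿ-pointwise {im w} {im z} (λ k → trans (im↝ w↝q k) (sym (im↝ z↝q k)))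

seq-re-sumList : ∀ {A : Set} (as : List A) (f : A → ℂ) k →
  seq (re (sumList as f)) k ≡ sum as λ a → seq (re (f a)) k
seq-re-sumList []       f k = refl
seq-re-sumList (a ∷ as) f k = cong (seq (re (f a)) k +_) (seq-re-sumList as f k)

seq-im-sumList : ∀ {A : Set} (as : List A) (f : A → ℂ) k →
  seq (im (sumList as f)) k ≡ sum as λ a → seq (im (f a)) k
seq-im-sumList []       f k = refl
seq-im-sumList (a ∷ as) f k = cong (seq (im (f a)) k +_) (seq-im-sumList as f k)

-- Positive semidefinite rational matrices

0≤p² : ∀ p → 0ℚ ≤ p * p
0≤p² p with ≤-total 0ℚ p
... | inj₁ 0≤p = subst (_≤ p * p) (*-zeroʳ p) (*-monoˡ-≤-nonNeg p {{nonNegative 0≤p}} 0≤p)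
... | inj₂ p≤0 = subst (_≤ p * p) (*-zeroʳ p) (*-monoˡ-≤-nonPos p {{nonPositive p≤0}} p≤0)

module _ {I : Set} (is : List I) where

  quadratic : (I → I → ℚ) → (I → ℚ) → ℚ
  quadratic e v = sum is λ i → v i * sum is λ j → e i j * v j

  -- Rational test vectors suffice, since a complex vector enters only through the terms of its
  -- Cauchy sequences. The record wrapper lets `e` be inferred from the type.
  record PSD (e : I → I → ℚ) : Set where
    field
      quadratic≥0 : ∀ v → 0ℚ ≤ quadratic e v

  open PSD public

  -- The form is the square of the sum of `v`. Together with `PSD-congruence` this gives all
  -- rank-one matrices `g i * g j`, from which the effects are built.
  PSD-one : PSD λ _ _ → 1ℚ
  quadratic≥0 (PSD-one) v = subst (0ℚ ≤_) (begin
    sum is v * sum is v                          ≡⟨ *-distribʳ-sum (sum is v) is v ⟩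
    sum is (λ i → v i * sum is v)
      ≡⟨ sum-cong is (λ i → cong (v i *_) (sum-cong is λ j → sym (*-identityˡ (v j)))) ⟩
    quadratic (λ _ _ → 1ℚ) v                     ∎) (0≤p² (sum is v))

  PSD-+ : ∀ {e f} → PSD e → PSD f → PSD λ i j → e i j + f i j
  quadratic≥0 (PSD-+ {e} {f} pe pf) v = subst (0ℚ ≤_) (begin
    quadratic e v + quadratic f v
      ≡⟨ sum-distrib-+ is _ _ ⟨
    sum is (λ i → v i * sum is (λ j → e i j * v j) + v i * sum is (λ j → f i j * v j))
      ≡⟨ sum-cong is (λ i → trans (sym (*-distribˡ-+ (v i) _ _)) (cong (v i *_)
           (trans (sym (sum-distrib-+ is _ _)) (sum-cong is λ j → sym (*-distribʳ-+ (v j) (e i j) (f i j)))))) ⟩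
    quadratic (λ i j → e i j + f i j) v ∎) (+-mono-≤ (quadratic≥0 pe v) (quadratic≥0 pf v))

  PSD-zero : PSD λ _ _ → 0ℚ
  quadratic≥0 (PSD-zero) v = sum-nonNeg is λ i → ≤-reflexive (sym (trans
    (cong (v i *_) (trans (sum-cong is λ j → *-zeroˡ (v j)) (sum-zero is))) (*-zeroʳ (v i))))

  PSD-sum : ∀ {K : Set} (ks : List K) {e : K → I → I → ℚ} →
    (∀ k → PSD (e k)) → PSD λ i j → sum ks λ k → e k i j
  PSD-sum []       pe = PSD-zero
  PSD-sum (k ∷ ks) pe = PSD-+ (pe k) (PSD-sum ks pe)

  PSD-scale : ∀ {c e} → 0ℚ ≤ c → PSD e → PSD λ i j → c * e i j
  quadratic≥0 (PSD-scale {c} {e} 0≤c pe) v = subst (0ℚ ≤_) (begin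
    c * quadratic e v
      ≡⟨ *-distribˡ-sum c is _ ⟩
    sum is (λ i → c * (v i * sum is λ j → e i j * v j))
      ≡⟨ sum-cong is (λ i → trans (swap c (v i) _)
           (cong (v i *_) (trans (*-distribˡ-sum c is _) (sum-cong is λ j → sym (*-assoc c (e i j) (v j)))))) ⟩
    quadratic (λ i j → c * e i j) v ∎)
    (subst (_≤ c * quadratic e v) (*-zeroʳ c) (*-monoˡ-≤-nonNeg c {{nonNegative 0≤c}} (quadratic≥0 pe v)))
    where
    open +-*-Solver
    swap : ∀ a b d → a * (b * d) ≡ b * (a * d)
    swap = solve 3 (λ a b d → a :* (b :* d) := b :* (a :* d)) refl

  -- The form at `v` is the form of `e` at the vector `g i * v i`.
  PSD-congruence : ∀ {e} (g : I → ℚ) → PSD e → PSD λ i j → g i * e i j * g j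
  quadratic≥0 (PSD-congruence {e} g pe) v = subst (0ℚ ≤_) (sum-cong is λ i → begin
    g i * v i * sum is (λ j → e i j * (g j * v j))
      ≡⟨ trans (cong (_* sum is (λ j → e i j * (g j * v j))) (*-comm (g i) (v i))) (*-assoc (v i) (g i) _) ⟩
    v i * (g i * sum is (λ j → e i j * (g j * v j)))
      ≡⟨ cong (v i *_) (trans (*-distribˡ-sum (g i) is _) (sum-cong is λ j → assoc₄ (g i) (e i j) (g j) (v j))) ⟩
    v i * sum is (λ j → g i * e i j * g j * v j) ∎) (quadratic≥0 pe λ i → g i * v i)
    where
    open +-*-Solver
    assoc₄ : ∀ a b c d → a * (b * (c * d)) ≡ a * b * c * d
    assoc₄ = solve 4 (λ a b c d → a :* (b :* (c :* d)) := a :* b :* c :* d) refl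

module _ {I : Set} (fin : Finite I) where
  open LinearAlgebra fin using (IsPositive; ⟨_∣_⟩; _$ᵒ_)

  -- For a real matrix the k-th term of ⟨v|Ev⟩ is the quadratic form at the
  -- k-th terms of the real and of the imaginary part of v.
  isPositive : ∀ {E : Operator I} {e} → (∀ i j → E i j ↝ e i j) →
    (∀ i j → e i j ≡ e j i) → PSD (elements fin) e → IsPositive E
  isPositive {E} {e} E↝e e-sym pe =
      (λ i j → ↝⇒≈ᶜ {conj (E j i)} {E i j} (↝-conj (E↝e j i)) (↝-subst (E↝e i j) (e-sym i j)))
    , λ v ε 0<ε → 0 , λ k _ → subst (λ q → 0ℚ < q + ε) (sym (form v k))
        (+-mono-≤-< (+-mono-≤ (quadratic≥0 pe λ i → seq (re (v i)) k) (quadratic≥0 pe λ i → seq (im (v i)) k)) 0<ε)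
    where
    form : ∀ v k → seq (re ⟨ v ∣ E $ᵒ v ⟩) k
      ≡ quadratic (elements fin) e (λ i → seq (re (v i)) k) + quadratic (elements fin) e (λ i → seq (im (v i)) k)
    form v k = begin
      seq (re ⟨ v ∣ E $ᵒ v ⟩) k
        ≡⟨ seq-re-sumList (elements fin) (λ i → conj (v i) *ᶜ (E $ᵒ v) i) k ⟩
      ∑ fin (λ i → a i * seq (re ((E $ᵒ v) i)) k - (- b i) * seq (im ((E $ᵒ v) i)) k)
        ≡⟨ sum-cong (elements fin) (λ i → trans
             (cong₂ (λ s t → a i * s - (- b i) * t) (re-apply i) (im-apply i))
             (neg-neg (a i * _) (b i) _)) ⟩
      ∑ fin (λ i → a i * ∑ fin (λ j → e i j * a j) + b i * ∑ fin (λ j → e i j * b j))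
        ≡⟨ sum-distrib-+ (elements fin) _ _ ⟩
      quadratic (elements fin) e a + quadratic (elements fin) e b ∎
      where
      a b : I → ℚ
      a i = seq (re (v i)) k
      b i = seq (im (v i)) k

      open +-*-Solver
      neg-neg : ∀ s t u → s - (- t) * u ≡ s + t * u
      neg-neg = solve 3 (λ s t u → s :- (:- t) :* u := s :+ t :* u) refl

      drop-imaginary : ∀ i j → e i j * a j - 0ℚ * b j ≡ e i j * a j
      drop-imaginary i j = trans (cong (λ q → e i j * a j - q) (*-zeroˡ (b j))) (+-identityʳ (e i j * a j))

      re-apply : ∀ i → seq (re ((E $ᵒ v) i)) k ≡ ∑ fin λ j → e i j * a j
      re-apply i = trans (seq-re-sumList (elements fin) (λ j → E i j *ᶜ v j) k) (sum-cong (elements fin) λ j →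
        trans (cong₂ (λ s t → s * a j - t * b j) (re↝ (E↝e i j) k) (im↝ (E↝e i j) k)) (drop-imaginary i j))

      im-apply : ∀ i → seq (im ((E $ᵒ v) i)) k ≡ ∑ fin λ j → e i j * b j
      im-apply i = trans (seq-im-sumList (elements fin) (λ j → E i j *ᶜ v j) k) (sum-cong (elements fin) λ j →
        trans (cong₂ (λ s t → s * b j + t * a j) (re↝ (E↝e i j) k) (im↝ (E↝e i j) k))
          (trans (cong (e i j * b j +_) (*-zeroˡ (a j))) (+-identityʳ (e i j * b j))))

-- Counting modulo p

toℚᵘ-sum-1 : ∀ {A : Set} (as : List A) →
  toℚᵘ (sum as λ _ → 1ℚ) ℚᵘ.≃ ℚᵘ.mkℚᵘ (ℤ.+ length as) 0
toℚᵘ-sum-1 []       = ℚᵘ.≃-refl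
toℚᵘ-sum-1 (a ∷ as) = ℚᵘ.≃-trans (toℚᵘ-homo-+ 1ℚ (sum as λ _ → 1ℚ))
  (ℚᵘ.≃-trans (ℚᵘ.+-congʳ ℚᵘ.1ℚᵘ (toℚᵘ-sum-1 as))
    (ℚᵘ.*≡* (cong (ℤ._* ℤ.1ℤ) (cong (ℤ._+_ ℤ.1ℤ) (ℤ.*-identityʳ (ℤ.+ length as))))))

-- Needed for the average over the group. A normalised fraction with a variable denominator does not
-- reduce, so the equation is checked on unnormalised rationals.
1/length*sum-1 : ∀ {A : Set} (as : List A) .{{_ : ℕ.NonZero (length as)}} →
  (ℤ.1ℤ / length as) * (sum as λ _ → 1ℚ) ≡ 1ℚ
1/length*sum-1 as@(_ ∷ bs) = toℚᵘ-injective
  (ℚᵘ.≃-trans (toℚᵘ-homo-* (ℤ.1ℤ / length as) (sum as λ _ → 1ℚ))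
    (ℚᵘ.≃-trans (ℚᵘ.*-cong (toℚᵘ-fromℚᵘ (ℚᵘ.mkℚᵘ ℤ.1ℤ (length bs))) (toℚᵘ-sum-1 as))
      (ℚᵘ.*≡* (trans (ℤ.*-identityʳ (ℤ.1ℤ ℤ.* (ℤ.+ length as)))
        (cong (λ k → ℤ.1ℤ ℤ.* (ℤ.+ k)) (sym (ℕ.*-identityʳ (length as))))))))

-- Linear equations over ℤₚ

module Residues (p : ℕ) {{_ : ℕ.NonZero p}} where
  open Modular p public renaming (_+_ to _+ₚ_; _*_ to _*ₚ_; -_ to -ₚ_)
    using (ℤₚ; 0#; 1#; _·_; _⊕_; ⊖_; 0ᵛ)
  private module M = Modular p

  ℤₚ-abelianGroup : AbelianGroup 0ℓ 0ℓ
  ℤₚ-abelianGroup = record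
    { isAbelianGroup = record
      { isGroup = record
        { isMonoid = record
          { isSemigroup = record
            { isMagma = record { isEquivalence = isEquivalence ; ∙-cong = cong₂ _+ₚ_ }
            ; assoc   = M.+-assoc
            }
          ; identity = M.+-identityˡ , M.+-identityʳ
          }
        ; inverse = M.+-inverseˡ , M.+-inverseʳ
        ; ⁻¹-cong = cong -ₚ_
        }
      ; comm = M.+-comm
      }
    }

  ⊕-abelianGroup : ℕ → AbelianGroup 0ℓ 0ℓ
  ⊕-abelianGroup m = record
    { Carrier        = Vec ℤₚ m
    ; isAbelianGroup = record
      { isGroup = record
        { isMonoid = record
          { isSemigroup = record
            { isMagma = record { isEquivalence = isEquivalence ; ∙-cong = cong₂ _⊕_ }
            ; assoc   = M.⊕-assoc
            }
          ; identity = M.⊕-identityˡ , M.⊕-identityʳ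
          }
        ; inverse = M.⊕-inverseˡ , M.⊕-inverseʳ
        ; ⁻¹-cong = cong ⊖_
        }
      ; comm = M.⊕-comm
      }
    }

  private module A = AbelianGroupProperties ℤₚ-abelianGroup

  infixl 6 _-ₚ_
  _-ₚ_ : ℤₚ → ℤₚ → ℤₚ
  a -ₚ b = a +ₚ -ₚ b

  -- (a - c) - (b - d) and (a - b) - (c - d) are the same element, and the latter vanishes.
  -ₚ-exchange : ∀ a b c d → a -ₚ b ≡ c -ₚ d → a -ₚ c ≡ b -ₚ d
  -ₚ-exchange a b c d eq = A.x∙y⁻¹≈ε⇒x≈y (a -ₚ c) (b -ₚ d) (begin
    (a -ₚ c) -ₚ (b -ₚ d)          ≡⟨ cong (a -ₚ c +ₚ_) (A.⁻¹-∙-comm b (-ₚ d)) ⟨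
    (a -ₚ c) +ₚ (-ₚ b -ₚ -ₚ d)    ≡⟨ M.interchange a (-ₚ c) (-ₚ b) (-ₚ -ₚ d) ⟩
    (a -ₚ b) +ₚ (-ₚ c -ₚ -ₚ d)    ≡⟨ cong (a -ₚ b +ₚ_) (A.⁻¹-∙-comm c (-ₚ d)) ⟩
    (a -ₚ b) -ₚ (c -ₚ d)          ≡⟨ A.x≈y⇒x∙y⁻¹≈ε eq ⟩
    0# ∎)

  *ₚ-distribˡ--ₚ : ∀ x a b → x *ₚ (a -ₚ b) ≡ x *ₚ a -ₚ x *ₚ b
  *ₚ-distribˡ--ₚ x a b = trans (M.*-distribˡ-+ x a (-ₚ b)) (cong (x *ₚ a +ₚ_)
    (A.inverseʳ-unique (x *ₚ b) (x *ₚ -ₚ b) (begin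
      x *ₚ b +ₚ x *ₚ -ₚ b   ≡⟨ M.*-distribˡ-+ x b (-ₚ b) ⟨
      x *ₚ (b -ₚ b)         ≡⟨ cong (x *ₚ_) (M.+-inverseʳ b) ⟩
      x *ₚ 0#               ≡⟨ M.*-zeroʳ x ⟩
      0#                    ∎)))

  +ₚ-cancelʳ : ∀ a b c → a +ₚ c ≡ b +ₚ c → a ≡ b
  +ₚ-cancelʳ a b c = A.∙-cancelʳ c a b

  toℕ-mod : ∀ k → toℕ (k mod p) ≡ k % p
  toℕ-mod k = Fin.toℕ-fromℕ< (m%n<n k p)

  mod-cong : ∀ {k l} → k % p ≡ l % p → k mod p ≡ l mod p
  mod-cong {k} {l} eq = Fin.toℕ-injective (trans (toℕ-mod k) (trans eq (sym (toℕ-mod l))))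

  toℕ-0# : toℕ 0# ≡ 0
  toℕ-0# = trans (toℕ-mod 0) (m<n⇒m%n≡m (ℕ.>-nonZero⁻¹ p))

  -ₚ-·-∷ : ∀ {m} u x₀ w₀ (x w : Vec ℤₚ m) →
    u -ₚ (x₀ ∷ x) · (w₀ ∷ w) ≡ u -ₚ x₀ *ₚ w₀ -ₚ x · w
  -ₚ-·-∷ u x₀ w₀ x w = trans (cong (u +ₚ_) (sym (A.⁻¹-∙-comm (x₀ *ₚ w₀) (x · w))))
    (sym (M.+-assoc u (-ₚ (x₀ *ₚ w₀)) (-ₚ (x · w))))

  finℤₚ : Finite ℤₚ
  finℤₚ = finFin p

  module _ (prime : Prime p) where

    0#≢1# : 0# ≢ 1#
    0#≢1# eq = ℕ.0≢1+n (trans (sym toℕ-0#) (trans (cong toℕ eq)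
      (trans (toℕ-mod 1) (m<n⇒m%n≡m (ℕ.nonTrivial⇒n>1 p {{prime⇒nonTrivial prime}})))))

    -- Primality makes p coprime to the representative `toℕ a`. Over ℕ, Bézout's identity comes in
    -- two forms, according to which side carries the 1.
    *ₚ-inverse : ∀ a → a ≢ 0# → ∃ λ b → b *ₚ a ≡ 1#
    *ₚ-inverse a a≢0 = from-Bézout (coprime-Bézout (prime⇒coprime prime {{ℕ.≢-nonZero t≢0}} (Fin.toℕ<n a)))
      where
      t : ℕ
      t = toℕ a

      t≢0 : t ≢ 0
      t≢0 t≡0 = a≢0 (Fin.toℕ-injective (trans t≡0 (sym toℕ-0#)))

      mod-*ₚ : ∀ k → (k mod p) *ₚ a ≡ (k ℕ.* t) mod p
      mod-*ₚ k = mod-cong (begin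
        (toℕ (k mod p) ℕ.* t) % p      ≡⟨ cong (λ m → (m ℕ.* t) % p) (toℕ-mod k) ⟩
        (k % p ℕ.* t) % p              ≡⟨ %-distribˡ-* (k % p) t p ⟩
        (k % p % p ℕ.* (t % p)) % p    ≡⟨ cong (λ m → (m ℕ.* (t % p)) % p) (m%n%n≡m%n k p) ⟩
        (k % p ℕ.* (t % p)) % p        ≡⟨ %-distribˡ-* k t p ⟨
        (k ℕ.* t) % p                  ∎)

      from-Bézout : Bézout.Identity 1 p t → ∃ λ b → b *ₚ a ≡ 1#
      from-Bézout (Bézout.-+ x y 1+xp≡yt) = y mod p ,
        trans (mod-*ₚ y) (mod-cong (trans (cong (_% p) (sym 1+xp≡yt)) ([m+kn]%n≡m%n 1 x p)))
      -- Here y t ≡ −1, so that y (y t) is inverse to t.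
      from-Bézout (Bézout.+- x y 1+yt≡xp) = (y ℕ.* (y ℕ.* t)) mod p ,
        trans (mod-*ₚ (y ℕ.* (y ℕ.* t))) (mod-cong (begin
          (y ℕ.* (y ℕ.* t) ℕ.* t) % p
            -- Without subtraction: adding the multiple 2xp = 2(1 + yt) of p completes (yt)² to 1 +
            -- (1 + yt)² = 1 + (xp)².
            ≡⟨ [m+kn]%n≡m%n (y ℕ.* (y ℕ.* t) ℕ.* t) (2 ℕ.* x) p ⟨
          (y ℕ.* (y ℕ.* t) ℕ.* t ℕ.+ 2 ℕ.* x ℕ.* p) % p
            ≡⟨ cong (_% p) square ⟩
          (1 ℕ.+ x ℕ.* p ℕ.* x ℕ.* p) % p
            ≡⟨ [m+kn]%n≡m%n 1 (x ℕ.* p ℕ.* x) p ⟩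
          1 % p ∎))
        where
        open ℕ.+-*-Solver
        square : y ℕ.* (y ℕ.* t) ℕ.* t ℕ.+ 2 ℕ.* x ℕ.* p ≡ 1 ℕ.+ x ℕ.* p ℕ.* x ℕ.* p
        square = begin
          y ℕ.* (y ℕ.* t) ℕ.* t ℕ.+ 2 ℕ.* x ℕ.* p
            ≡⟨ solve 4 (λ y t x p → y :* (y :* t) :* t :+ con 2 :* x :* p := (y :* t) :* (y :* t) :+ con 2 :* (x :* p)) refl y t x p ⟩
          (y ℕ.* t) ℕ.* (y ℕ.* t) ℕ.+ 2 ℕ.* (x ℕ.* p)
            ≡⟨ cong (λ k → (y ℕ.* t) ℕ.* (y ℕ.* t) ℕ.+ 2 ℕ.* k) 1+yt≡xp ⟨
          (y ℕ.* t) ℕ.* (y ℕ.* t) ℕ.+ 2 ℕ.* (1 ℕ.+ y ℕ.* t)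
            ≡⟨ solve 1 (λ s → s :* s :+ con 2 :* (con 1 :+ s) := con 1 :+ (con 1 :+ s) :* (con 1 :+ s)) refl (y ℕ.* t) ⟩
          1 ℕ.+ (1 ℕ.+ y ℕ.* t) ℕ.* (1 ℕ.+ y ℕ.* t)
            ≡⟨ cong (λ k → 1 ℕ.+ k ℕ.* k) 1+yt≡xp ⟩
          1 ℕ.+ (x ℕ.* p) ℕ.* (x ℕ.* p)
            ≡⟨ cong suc (sym (ℕ.*-assoc (x ℕ.* p) x p)) ⟩
          1 ℕ.+ x ℕ.* p ℕ.* x ℕ.* p ∎

    -- The equation says x (a - b) = u - u′, and a - b is invertible. The two implications are what
    -- is needed to replace its indicator by `δ finℤₚ x₀ x`.
    unique-solution : ∀ {a b} → a ≢ b → ∀ u u′ → ∃ λ x₀ → ∀ x →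
      (u -ₚ x *ₚ a ≡ u′ -ₚ x *ₚ b → x₀ ≡ x) × (x₀ ≡ x → u -ₚ x *ₚ a ≡ u′ -ₚ x *ₚ b)
    unique-solution {a} {b} a≢b u u′
      with d⁻¹ , d⁻¹d≡1 ← *ₚ-inverse (a -ₚ b) (λ d≡0 → a≢b (A.x∙y⁻¹≈ε⇒x≈y a b d≡0))
      = (u -ₚ u′) *ₚ d⁻¹ , λ x → to x , from x
      where
      to : ∀ x → u -ₚ x *ₚ a ≡ u′ -ₚ x *ₚ b → (u -ₚ u′) *ₚ d⁻¹ ≡ x
      to x eq = begin
        (u -ₚ u′) *ₚ d⁻¹               ≡⟨ cong (_*ₚ d⁻¹) (-ₚ-exchange u (x *ₚ a) u′ (x *ₚ b) eq) ⟩
        (x *ₚ a -ₚ x *ₚ b) *ₚ d⁻¹      ≡⟨ cong (_*ₚ d⁻¹) (*ₚ-distribˡ--ₚ x a b) ⟨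
        x *ₚ (a -ₚ b) *ₚ d⁻¹           ≡⟨ trans (M.*-assoc x (a -ₚ b) d⁻¹) (cong (x *ₚ_) (trans (M.*-comm (a -ₚ b) d⁻¹) d⁻¹d≡1)) ⟩
        x *ₚ 1#                        ≡⟨ trans (M.*-comm x 1#) (M.*-identityˡ x) ⟩
        x                              ∎

      from : ∀ x → (u -ₚ u′) *ₚ d⁻¹ ≡ x → u -ₚ x *ₚ a ≡ u′ -ₚ x *ₚ b
      from x refl = -ₚ-exchange u u′ (x *ₚ a) (x *ₚ b) (sym (begin
        x *ₚ a -ₚ x *ₚ b                  ≡⟨ *ₚ-distribˡ--ₚ x a b ⟨
        (u -ₚ u′) *ₚ d⁻¹ *ₚ (a -ₚ b)      ≡⟨ trans (M.*-assoc (u -ₚ u′) d⁻¹ (a -ₚ b)) (cong ((u -ₚ u′) *ₚ_) d⁻¹d≡1) ⟩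
        (u -ₚ u′) *ₚ 1#                   ≡⟨ trans (M.*-comm (u -ₚ u′) 1#) (M.*-identityˡ (u -ₚ u′)) ⟩
        u -ₚ u′                           ∎))

    -- Induction on the dimension, splitting off the first coordinate `x₀`. The offsets are
    -- arbitrary because fixing `x₀` changes them to `u -ₚ x₀ *ₚ w₀` and `u′ -ₚ x₀ *ₚ w₀′`. The
    -- factor p on the left avoids a division.
    hyperplane-count : ∀ {m} u u′ (w w′ : Vec ℤₚ m) → w ≢ w′ →
      card finℤₚ * ∑ (finVec finℤₚ m) (λ x → δ finℤₚ (u -ₚ x · w) (u′ -ₚ x · w′)) ≡ card (finVec finℤₚ m)
    hyperplane-count {zero}  u u′ []       []         w≢w′ = ⊥-elim (w≢w′ refl)
    hyperplane-count {suc m} u u′ (w₀ ∷ w) (w₀′ ∷ w′) w≢w′ = begin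
      card finℤₚ * ∑ (finVec finℤₚ (suc m)) (λ x → δ finℤₚ (u -ₚ x · (w₀ ∷ w)) (u′ -ₚ x · (w₀′ ∷ w′)))
        ≡⟨ cong (card finℤₚ *_) (∑-∷ finℤₚ m _) ⟩
      card finℤₚ * ∑ finℤₚ (λ x₀ → ∑ (finVec finℤₚ m) λ x →
          δ finℤₚ (u -ₚ (x₀ ∷ x) · (w₀ ∷ w)) (u′ -ₚ (x₀ ∷ x) · (w₀′ ∷ w′)))
        ≡⟨ cong (card finℤₚ *_) (sum-cong (elements finℤₚ) λ x₀ → sum-cong (elements (finVec finℤₚ m)) λ x →
             cong₂ (δ finℤₚ) (-ₚ-·-∷ u x₀ w₀ x w) (-ₚ-·-∷ u′ x₀ w₀′ x w′)) ⟩
      card finℤₚ * ∑ finℤₚ (λ x₀ → ∑ (finVec finℤₚ m) λ x →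
          δ finℤₚ (u -ₚ x₀ *ₚ w₀ -ₚ x · w) (u′ -ₚ x₀ *ₚ w₀′ -ₚ x · w′))
        ≡⟨ step (_≟_ (finVec finℤₚ m) w w′) ⟩
      card (finVec finℤₚ (suc m)) ∎
      where
      step : Dec (w ≡ w′) → card finℤₚ * ∑ finℤₚ (λ x₀ → ∑ (finVec finℤₚ m) λ x →
          δ finℤₚ (u -ₚ x₀ *ₚ w₀ -ₚ x · w) (u′ -ₚ x₀ *ₚ w₀′ -ₚ x · w′)) ≡ card (finVec finℤₚ (suc m))
      -- Different tails: the induction hypothesis applies to each of the p choices of `x₀`.
      step (no w≢w′) = begin
        card finℤₚ * ∑ finℤₚ (λ x₀ → ∑ (finVec finℤₚ m) λ x →
            δ finℤₚ (u -ₚ x₀ *ₚ w₀ -ₚ x · w) (u′ -ₚ x₀ *ₚ w₀′ -ₚ x · w′))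
          ≡⟨ *-distribˡ-sum (card finℤₚ) (elements finℤₚ) _ ⟩
        ∑ finℤₚ (λ x₀ → card finℤₚ * ∑ (finVec finℤₚ m) λ x →
            δ finℤₚ (u -ₚ x₀ *ₚ w₀ -ₚ x · w) (u′ -ₚ x₀ *ₚ w₀′ -ₚ x · w′))
          ≡⟨ sum-cong (elements finℤₚ) (λ x₀ → hyperplane-count (u -ₚ x₀ *ₚ w₀) (u′ -ₚ x₀ *ₚ w₀′) w w′ w≢w′) ⟩
        ∑ finℤₚ (λ _ → card (finVec finℤₚ m))
          ≡⟨ trans (sum-const (card (finVec finℤₚ m)) (elements finℤₚ)) (*-comm (card (finVec finℤₚ m)) (card finℤₚ)) ⟩
        card finℤₚ * card (finVec finℤₚ m)
          ≡⟨ card-∷ finℤₚ m ⟨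
        card (finVec finℤₚ (suc m)) ∎
      -- Equal tails cancel, so the first coordinates differ: exactly one `x₀` works, and the rest
      -- of the vector is free.
      step (yes refl) with x* , sol ← unique-solution (λ w₀≡w₀′ → w≢w′ (cong (_∷ w) w₀≡w₀′)) u u′ = begin
        card finℤₚ * ∑ finℤₚ (λ x₀ → ∑ (finVec finℤₚ m) λ x →
            δ finℤₚ (u -ₚ x₀ *ₚ w₀ -ₚ x · w) (u′ -ₚ x₀ *ₚ w₀′ -ₚ x · w))
          ≡⟨ cong (card finℤₚ *_) (sum-cong (elements finℤₚ) λ x₀ →
               trans (sum-cong (elements (finVec finℤₚ m)) λ x →
                 𝟙-cong (_≟_ finℤₚ _ _) (_≟_ finℤₚ x* x₀)
                   (λ eq → proj₁ (sol x₀) (+ₚ-cancelʳ _ _ (-ₚ (x · w)) eq))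
                   (λ eq → cong (_-ₚ x · w) (proj₂ (sol x₀) eq)))
               (trans (sum-const (δ finℤₚ x* x₀) (elements (finVec finℤₚ m)))
                 (*-comm (δ finℤₚ x* x₀) (card (finVec finℤₚ m))))) ⟩
        card finℤₚ * ∑ finℤₚ (λ x₀ → card (finVec finℤₚ m) * δ finℤₚ x* x₀)
          ≡⟨ cong (card finℤₚ *_) (∑-δʳ finℤₚ x* λ _ → card (finVec finℤₚ m)) ⟩
        card finℤₚ * card (finVec finℤₚ m)
          ≡⟨ card-∷ finℤₚ m ⟨
        card (finVec finℤₚ (suc m)) ∎

-- The algorithm

lookup-injective : ∀ {A : Set} {as : List A} → Unique as → ∀ {i j} → lookup as i ≡ lookup as j → i ≡ j
lookup-injective (_ ∷ _)      {Fin.zero}  {Fin.zero}  eq = refl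
lookup-injective (a∉as ∷ _)   {Fin.zero}  {Fin.suc j} eq = ⊥-elim (All.lookup a∉as (Membership.∈-lookup j) eq)
lookup-injective (a∉as ∷ _)   {Fin.suc i} {Fin.zero}  eq = ⊥-elim (All.lookup a∉as (Membership.∈-lookup i) (sym eq))
lookup-injective (_ ∷ as!)    {Fin.suc i} {Fin.suc j} eq = cong Fin.suc (lookup-injective as! eq)

-- Quadratic forms at signed superpositions of basis vectors

module Superposition {I Q : Set} (fin : Finite I) (finQ : Finite Q) (μ : ℚ) where

  superposition : (P P′ : Q → I) → I → ℚ
  superposition P P′ i = μ * ∑ finQ λ q → δ fin (P q) i - δ fin (P′ q) i

  ∑-superposition : ∀ P P′ (f : I → ℚ) →
    ∑ fin (λ i → f i * superposition P P′ i) ≡ μ * ∑ finQ λ q → f (P q) - f (P′ q)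
  ∑-superposition P P′ f = begin
    ∑ fin (λ i → f i * (μ * ∑ finQ (λ q → δ fin (P q) i - δ fin (P′ q) i)))
      ≡⟨ sum-cong (elements fin) (λ i → trans (swap (f i) μ _) (cong (μ *_) (*-distribˡ-sum (f i) (elements finQ) _))) ⟩
    ∑ fin (λ i → μ * ∑ finQ (λ q → f i * (δ fin (P q) i - δ fin (P′ q) i)))
      ≡⟨ *-distribˡ-sum μ (elements fin) _ ⟨
    μ * ∑ fin (λ i → ∑ finQ (λ q → f i * (δ fin (P q) i - δ fin (P′ q) i)))
      ≡⟨ cong (μ *_) (sum-comm (elements fin) (elements finQ) _) ⟩
    μ * ∑ finQ (λ q → ∑ fin (λ i → f i * (δ fin (P q) i - δ fin (P′ q) i)))
      ≡⟨ cong (μ *_) (sum-cong (elements finQ) λ q → trans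
           (sum-cong (elements fin) λ i → distrib (f i) (δ fin (P q) i) (δ fin (P′ q) i))
           (trans (sum-distrib-- (elements fin) _ _)
             (cong₂ _-_ (∑-δʳ fin (P q) f) (∑-δʳ fin (P′ q) f)))) ⟩
    μ * ∑ finQ (λ q → f (P q) - f (P′ q)) ∎
    where
    open +-*-Solver
    swap : ∀ a b c → a * (b * c) ≡ b * (a * c)
    swap = solve 3 (λ a b c → a :* (b :* c) := b :* (a :* c)) refl
    distrib : ∀ a b c → a * (b - c) ≡ a * b - a * c
    distrib = solve 3 (λ a b c → a :* (b :- c) := a :* b :- a :* c) refl

  -- The four signed entries are the interference terms of |P⟩ - |P′⟩. With `e` the identity matrix
  -- this computes the norm of a state, with `e` an effect the probability of an outcome.
  quadratic-superposition : ∀ P P′ (e : I → I → ℚ) →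
    quadratic (elements fin) e (superposition P P′) ≡
    μ * ∑ finQ λ q → μ * ∑ finQ λ r → (e (P q) (P r) - e (P q) (P′ r)) - (e (P′ q) (P r) - e (P′ q) (P′ r))
  quadratic-superposition P P′ e = begin
    ∑ fin (λ i → superposition P P′ i * ∑ fin (λ j → e i j * superposition P P′ j))
      ≡⟨ sum-cong (elements fin) (λ i → trans (*-comm (superposition P P′ i) _)
           (cong (_* superposition P P′ i) (∑-superposition P P′ (e i)))) ⟩
    ∑ fin (λ i → F i * superposition P P′ i)
      ≡⟨ ∑-superposition P P′ F ⟩
    μ * ∑ finQ (λ q → F (P q) - F (P′ q))
      ≡⟨ cong (μ *_) (sum-cong (elements finQ) λ q → trans
           (factor μ (∑ finQ λ r → e (P q) (P r) - e (P q) (P′ r)) (∑ finQ λ r → e (P′ q) (P r) - e (P′ q) (P′ r)))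
           (cong (μ *_) (sym (sum-distrib-- (elements finQ) _ _)))) ⟩
    μ * ∑ finQ (λ q → μ * ∑ finQ λ r → (e (P q) (P r) - e (P q) (P′ r)) - (e (P′ q) (P r) - e (P′ q) (P′ r))) ∎
    where
    F : I → ℚ
    F i = μ * ∑ finQ λ r → e i (P r) - e i (P′ r)
    open +-*-Solver
    factor : ∀ a b c → a * b - a * c ≡ a * (b - c)
    factor = solve 3 (λ a b c → a :* b :- a :* c := a :* (b :- c)) refl

module Algorithm (p : ℕ) {{_ : ℕ.NonZero p}} (prime : Prime p) (n : ℕ) where
  open Residues p
  open Heisenberg p n using (G; X; _▷_; ▷-formula; finG)
  private
    module M = Modular p
    module Z = AbelianGroupProperties ℤₚ-abelianGroup
    module V = AbelianGroupProperties (⊕-abelianGroup n)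

  W R T Q I : Set
  W = Vec ℤₚ n
  R = Fin 2 × W
  T = ℤₚ × R

  finW : Finite W
  finW = finVec finℤₚ n
  finR : Finite R
  finR = finFin 2 ×ᶠ finW
  finT : Finite T
  finT = finℤₚ ×ᶠ finR
  finWR : Finite (W × R)
  finWR = finW ×ᶠ finR
  finX : Finite X
  finX = finVec finℤₚ (2 ℕ.+ n)

  N : ℕ
  N = length (elements finWR)
  Q = Fin N
  I = X × Q

  finQ : Finite Q
  finQ = finFin N
  finI : Finite I
  finI = finX ×ᶠ finQ

  -- The ancilla of dimension N holds a pair (w , r); the register r only
  -- serves to make the norm of the state rational.
  label : Q → W × R
  label = lookup (elements finWR)

  copy : Q → W
  copy q = proj₁ (label q)

  label-injective : ∀ {q q′} → label q ≡ label q′ → q ≡ q′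
  label-injective = lookup-injective (unique finWR)

  first : I → ℤₚ
  first (v , q) = head v

  middle : I → W
  middle (v , q) = init (tail v)

  -- The data that the measurement reads off classically: effects are block diagonal with respect to
  -- it. Its first component becomes y after a query.
  outcome : I → W × T
  outcome (v , q) = init (tail v) ⊕ ⊖ copy q , last (tail v) , proj₂ (label q)

  shear : W → I → ℤₚ
  shear x i = first i -ₚ x · middle i

  -- Once `middle` is known, the first component of the outcome gives back `copy q` by cancellation;
  -- together with the register r it determines the label and hence `q`.
  I-ext : ∀ i j → outcome i ≡ outcome j → middle i ≡ middle j → first i ≡ first j → i ≡ j
  I-ext (u ∷ v , q) (u′ ∷ v′ , q′) eq w≡w′ refl with initLast v | initLast v′
  I-ext (u ∷ v , q) (u′ ∷ v′ , q′) eq refl refl | w , t , refl | w , t′ , refl =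
    cong₂ (λ t q → (u ∷ (w ∷ʳ t)) , q) (cong (proj₁ ∘ proj₂) eq)
      (label-injective (cong₂ _,_
        (V.⁻¹-injective (V.∙-cancelˡ w (⊖ copy q) (⊖ copy q′) (cong proj₁ eq)))
        (cong (proj₂ ∘ proj₂) eq)))

  -- The effects of the measurement and their completeness

  ω π ω⁻¹ π⁻¹ : ℚ
  ω   = card finW
  π   = card finℤₚ
  ω⁻¹ = proj₁ (card-inverse finW 0ᵛ)
  π⁻¹ = proj₁ (card-inverse finℤₚ 0#)

  0≤ω⁻¹ : 0ℚ ≤ ω⁻¹
  0≤ω⁻¹ = proj₁ (proj₂ (card-inverse finW 0ᵛ))
  0≤π⁻¹ : 0ℚ ≤ π⁻¹
  0≤π⁻¹ = proj₁ (proj₂ (card-inverse finℤₚ 0#))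
  ωω⁻¹≡1 : ω * ω⁻¹ ≡ 1ℚ
  ωω⁻¹≡1 = proj₂ (proj₂ (card-inverse finW 0ᵛ))
  ππ⁻¹≡1 : π * π⁻¹ ≡ 1ℚ
  ππ⁻¹≡1 = proj₂ (proj₂ (card-inverse finℤₚ 0#))

  -- Both summands are nonnegative multiples of Gram matrices, which makes positivity immediate;
  -- `1ℚ` is the entry of the all-ones matrix to which `PSD-congruence` is applied. The first
  -- summand pulls back along `shear x` the projection onto the nontrivial characters of ℤₚ, the
  -- second supplies the completion. `kernel-closed` has the explicit entries.
  kernel : W → I → I → ℚ
  kernel x i j = ω⁻¹ *
    ( ∑ finℤₚ (λ s → (δ finℤₚ (shear x i) s - π⁻¹) * 1ℚ * (δ finℤₚ (shear x j) s - π⁻¹))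
    + π⁻¹ * ∑ finW (λ w → δ finW (middle i) w * 1ℚ * δ finW (middle j) w))

  -- Multiplying by the indicator of an outcome on both sides cuts out a diagonal block and
  -- preserves positivity; the sum over `t` joins the blocks whose outcome begins with `y`.
  effect : W → W → I → I → ℚ
  effect x y i j = ∑ finT λ t →
    δ (finW ×ᶠ finT) (outcome i) (y , t) * kernel x i j * δ (finW ×ᶠ finT) (outcome j) (y , t)

  is : List I
  is = elements finI

  effect-psd : ∀ x y → PSD is (effect x y)
  effect-psd x y = PSD-sum is (elements finT) λ t →
    PSD-congruence is (λ i → δ (finW ×ᶠ finT) (outcome i) (y , t)) (PSD-scale is 0≤ω⁻¹ (PSD-+ is
      (PSD-sum is (elements finℤₚ) λ s → PSD-congruence is (λ i → δ finℤₚ (shear x i) s - π⁻¹) (PSD-one is))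
      (PSD-scale is 0≤π⁻¹ (PSD-sum is (elements finW) λ w →
        PSD-congruence is (λ i → δ finW (middle i) w) (PSD-one is)))))

  flip-* : ∀ a b c → a * b * c ≡ c * b * a
  flip-* = solve 3 (λ a b c → a :* b :* c := c :* b :* a) refl
    where open +-*-Solver

  kernel-sym : ∀ x i j → kernel x i j ≡ kernel x j i
  kernel-sym x i j = cong (ω⁻¹ *_) (cong₂ _+_
    (sum-cong (elements finℤₚ) λ s → flip-* (δ finℤₚ (shear x i) s - π⁻¹) 1ℚ (δ finℤₚ (shear x j) s - π⁻¹))
    (cong (π⁻¹ *_) (sum-cong (elements finW) λ w → flip-* (δ finW (middle i) w) 1ℚ (δ finW (middle j) w))))

  effect-sym : ∀ x y i j → effect x y i j ≡ effect x y j i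
  effect-sym x y i j = sum-cong (elements finT) λ t → trans
    (cong (λ k → δ (finW ×ᶠ finT) (outcome i) (y , t) * k * δ (finW ×ᶠ finT) (outcome j) (y , t)) (kernel-sym x i j))
    (flip-* (δ (finW ×ᶠ finT) (outcome i) (y , t)) (kernel x j i) (δ (finW ×ᶠ finT) (outcome j) (y , t)))

  -- The matrix with entries `δ finℤₚ a b - π⁻¹` is the orthogonal projection off the constant
  -- vectors; the sum is its square.
  ∑-centred : ∀ a b → ∑ finℤₚ (λ s → (δ finℤₚ a s - π⁻¹) * 1ℚ * (δ finℤₚ b s - π⁻¹)) ≡ δ finℤₚ a b - π⁻¹
  ∑-centred a b = begin
    ∑ finℤₚ (λ s → (δ finℤₚ a s - π⁻¹) * 1ℚ * (δ finℤₚ b s - π⁻¹))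
      ≡⟨ sum-cong (elements finℤₚ) (λ s → expand (δ finℤₚ a s) (δ finℤₚ b s) π⁻¹) ⟩
    ∑ finℤₚ (λ s → (δ finℤₚ a s * δ finℤₚ b s - π⁻¹ * δ finℤₚ a s) + (π⁻¹ * π⁻¹ - π⁻¹ * δ finℤₚ b s))
      ≡⟨ trans (sum-distrib-+ (elements finℤₚ) _ _)
           (cong₂ _+_ (sum-distrib-- (elements finℤₚ) _ _) (sum-distrib-- (elements finℤₚ) _ _)) ⟩
    (∑ finℤₚ (λ s → δ finℤₚ a s * δ finℤₚ b s) - ∑ finℤₚ (λ s → π⁻¹ * δ finℤₚ a s))
      + (∑ finℤₚ (λ s → π⁻¹ * π⁻¹) - ∑ finℤₚ (λ s → π⁻¹ * δ finℤₚ b s))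
      ≡⟨ cong₂ _+_ (cong₂ _-_ (∑-δδ finℤₚ a b) (∑-δʳ finℤₚ a λ _ → π⁻¹))
                   (cong₂ _-_ (sum-const (π⁻¹ * π⁻¹) (elements finℤₚ)) (∑-δʳ finℤₚ b λ _ → π⁻¹)) ⟩
    (δ finℤₚ a b - π⁻¹) + (π⁻¹ * π⁻¹ * π - π⁻¹)
      ≡⟨ cong (λ k → (δ finℤₚ a b - π⁻¹) + (k - π⁻¹)) (begin
           π⁻¹ * π⁻¹ * π     ≡⟨ *-assoc π⁻¹ π⁻¹ π ⟩
           π⁻¹ * (π⁻¹ * π)   ≡⟨ cong (π⁻¹ *_) (trans (*-comm π⁻¹ π) ππ⁻¹≡1) ⟩
           π⁻¹ * 1ℚ          ≡⟨ *-identityʳ π⁻¹ ⟩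
           π⁻¹               ∎) ⟩
    (δ finℤₚ a b - π⁻¹) + (π⁻¹ - π⁻¹)
      ≡⟨ trans (cong ((δ finℤₚ a b - π⁻¹) +_) (+-inverseʳ π⁻¹)) (+-identityʳ _) ⟩
    δ finℤₚ a b - π⁻¹ ∎
    where
    open +-*-Solver
    expand : ∀ a b c → (a - c) * 1ℚ * (b - c) ≡ (a * b - c * a) + (c * c - c * b)
    expand = solve 3 (λ a b c → (a :- c) :* con 1ℚ :* (b :- c) := (a :* b :- c :* a) :+ (c :* c :- c :* b)) refl

  kernel-closed : ∀ x i j →
    kernel x i j ≡ ω⁻¹ * ((δ finℤₚ (shear x i) (shear x j) - π⁻¹) + π⁻¹ * δ finW (middle i) (middle j))
  kernel-closed x i j = cong (ω⁻¹ *_) (cong₂ _+_ (∑-centred (shear x i) (shear x j))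
    (cong (π⁻¹ *_) (trans
      (sum-cong (elements finW) λ w → cong (_* δ finW (middle j) w) (*-identityʳ (δ finW (middle i) w)))
      (∑-δδ finW (middle i) (middle j)))))

  -- If the `middle` registers agree, the correction vanishes and every `x` satisfies the shear
  -- equation or none does. If they differ, a fraction 1/p of all `x` satisfies it, which the
  -- correction cancels exactly.
  shear-count : ∀ i j →
    ∑ finW (λ x → δ finℤₚ (shear x i) (shear x j)) + ω * (π⁻¹ * δ finW (middle i) (middle j) - π⁻¹)
      ≡ ω * (δ finW (middle i) (middle j) * δ finℤₚ (first i) (first j))
  shear-count i j = step (_≟_ finW (middle i) (middle j))
    where
    -- Generalising over the decision lets a match on it evaluate the indicator on both sides.
    step : (d : Dec (middle i ≡ middle j)) →
      ∑ finW (λ x → δ finℤₚ (shear x i) (shear x j)) + ω * (π⁻¹ * 𝟙 d - π⁻¹)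
        ≡ ω * (𝟙 d * δ finℤₚ (first i) (first j))
    step (yes w≡w′) = begin
      ∑ finW (λ x → δ finℤₚ (shear x i) (shear x j)) + ω * (π⁻¹ * 1ℚ - π⁻¹)
        ≡⟨ cong₂ _+_ (trans (sum-cong (elements finW) λ x →
             𝟙-cong (_≟_ finℤₚ (shear x i) (shear x j)) (_≟_ finℤₚ (first i) (first j))
               (λ eq → +ₚ-cancelʳ (first i) (first j) (-ₚ (x · middle j))
                 (subst (λ w → first i -ₚ x · w ≡ shear x j) w≡w′ eq))
               (λ eq → cong₂ (λ u w → u -ₚ x · w) eq w≡w′))
             (sum-const (δ finℤₚ (first i) (first j)) (elements finW)))
           (cancel ω π⁻¹) ⟩
      δ finℤₚ (first i) (first j) * ω + 0ℚ
        ≡⟨ trans (+-identityʳ _) (*-comm (δ finℤₚ (first i) (first j)) ω) ⟩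
      ω * δ finℤₚ (first i) (first j)
        ≡⟨ cong (ω *_) (*-identityˡ (δ finℤₚ (first i) (first j))) ⟨
      ω * (1ℚ * δ finℤₚ (first i) (first j)) ∎
      where
      open +-*-Solver
      cancel : ∀ a b → a * (b * 1ℚ - b) ≡ 0ℚ
      cancel = solve 2 (λ a b → a :* (b :* con 1ℚ :- b) := con 0ℚ) refl
    step (no w≢w′) = begin
      S + ω * (π⁻¹ * 0ℚ - π⁻¹)
        -- The count is read backwards: `ω` becomes `π * S`, after which `π * π⁻¹` cancels.
        ≡⟨ cong (λ k → S + k * (π⁻¹ * 0ℚ - π⁻¹)) (hyperplane-count prime (first i) (first j) (middle i) (middle j) w≢w′) ⟨
      S + π * S * (π⁻¹ * 0ℚ - π⁻¹)
        ≡⟨ rearrange S π π⁻¹ ⟩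
      S - S * (π * π⁻¹)
        ≡⟨ cong (λ k → S - S * k) ππ⁻¹≡1 ⟩
      S - S * 1ℚ
        ≡⟨ cancel S ω (δ finℤₚ (first i) (first j)) ⟩
      ω * (0ℚ * δ finℤₚ (first i) (first j)) ∎
      where
      S : ℚ
      S = ∑ finW λ x → δ finℤₚ (shear x i) (shear x j)
      open +-*-Solver
      rearrange : ∀ a b c → a + b * a * (c * 0ℚ - c) ≡ a - a * (b * c)
      rearrange = solve 3 (λ a b c → a :+ b :* a :* (c :* con 0ℚ :- c) := a :- a :* (b :* c)) refl
      cancel : ∀ a b c → a - a * 1ℚ ≡ b * (0ℚ * c)
      cancel = solve 3 (λ a b c → a :- a :* con 1ℚ := b :* (con 0ℚ :* c)) refl

  ∑-kernel : ∀ i j → ∑ finW (λ x → kernel x i j) ≡ δ finW (middle i) (middle j) * δ finℤₚ (first i) (first j)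
  ∑-kernel i j = begin
    ∑ finW (λ x → kernel x i j)
      ≡⟨ sum-cong (elements finW) (λ x → trans (kernel-closed x i j)
           (cong (ω⁻¹ *_) (+-assoc (δ finℤₚ (shear x i) (shear x j)) (- π⁻¹) (π⁻¹ * d)))) ⟩
    ∑ finW (λ x → ω⁻¹ * (δ finℤₚ (shear x i) (shear x j) + (- π⁻¹ + π⁻¹ * d)))
      ≡⟨ trans (sym (*-distribˡ-sum ω⁻¹ (elements finW) _)) (cong (ω⁻¹ *_) (sum-distrib-+ (elements finW) _ _)) ⟩
    ω⁻¹ * (S + ∑ finW (λ _ → - π⁻¹ + π⁻¹ * d))
      ≡⟨ cong (λ k → ω⁻¹ * (S + k)) (trans (sum-const (- π⁻¹ + π⁻¹ * d) (elements finW))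
           (trans (*-comm (- π⁻¹ + π⁻¹ * d) ω) (cong (ω *_) (+-comm (- π⁻¹) (π⁻¹ * d))))) ⟩
    ω⁻¹ * (S + ω * (π⁻¹ * d - π⁻¹))
      ≡⟨ cong (ω⁻¹ *_) (shear-count i j) ⟩
    ω⁻¹ * (ω * (d * δ finℤₚ (first i) (first j)))
      ≡⟨ trans (sym (*-assoc ω⁻¹ ω _)) (cong (_* (d * δ finℤₚ (first i) (first j))) (trans (*-comm ω⁻¹ ω) ωω⁻¹≡1)) ⟩
    1ℚ * (d * δ finℤₚ (first i) (first j))
      ≡⟨ *-identityˡ _ ⟩
    d * δ finℤₚ (first i) (first j) ∎
    where
    S d : ℚ
    S = ∑ finW λ x → δ finℤₚ (shear x i) (shear x j)
    d = δ finW (middle i) (middle j)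

  -- The sum over `x` leaves the condition that `middle` and `first` agree, the sum over `y` and `t`
  -- that the outcomes agree. By `I-ext` these together mean `i ≡ j`.
  ∑-effect : ∀ i j → ∑ (finW ×ᶠ finW) (λ (x , y) → effect x y i j) ≡ δ finI i j
  ∑-effect i j = begin
    ∑ (finW ×ᶠ finW) (λ (x , y) → effect x y i j)
      ≡⟨ ∑-× finW finW _ ⟩
    ∑ finW (λ x → ∑ finW λ y → ∑ finT λ t → o i (y , t) * kernel x i j * o j (y , t))
      ≡⟨ sum-cong (elements finW) (λ x → trans (sym (∑-× finW finT _))
           (trans (sum-cong (elements (finW ×ᶠ finT)) λ yt → regroup (o i yt) (kernel x i j) (o j yt))
           (trans (sym (*-distribˡ-sum (kernel x i j) (elements (finW ×ᶠ finT)) _))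
             (cong (kernel x i j *_) (∑-δδ (finW ×ᶠ finT) (outcome i) (outcome j)))))) ⟩
    ∑ finW (λ x → kernel x i j * δ (finW ×ᶠ finT) (outcome i) (outcome j))
      ≡⟨ *-distribʳ-sum (δ (finW ×ᶠ finT) (outcome i) (outcome j)) (elements finW) _ ⟨
    ∑ finW (λ x → kernel x i j) * δ (finW ×ᶠ finT) (outcome i) (outcome j)
      ≡⟨ cong (_* δ (finW ×ᶠ finT) (outcome i) (outcome j)) (trans (∑-kernel i j)
           (𝟙-* (_≟_ finW (middle i) (middle j)) (_≟_ finℤₚ (first i) (first j))
             (_≟_ (finW ×ᶠ finℤₚ) (middle i , first i) (middle j , first j))
             (cong₂ _,_) λ eq → cong proj₁ eq , cong proj₂ eq)) ⟩
    δ (finW ×ᶠ finℤₚ) (middle i , first i) (middle j , first j) * δ (finW ×ᶠ finT) (outcome i) (outcome j)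
      ≡⟨ 𝟙-* (_≟_ (finW ×ᶠ finℤₚ) (middle i , first i) (middle j , first j))
           (_≟_ (finW ×ᶠ finT) (outcome i) (outcome j)) (_≟_ finI i j)
           (λ eq eq′ → I-ext i j eq′ (cong proj₁ eq) (cong proj₂ eq))
           (λ eq → cong (λ k → middle k , first k) eq , cong outcome eq) ⟩
    δ finI i j ∎
    where
    o : I → W × T → ℚ
    o i = δ (finW ×ᶠ finT) (outcome i)
    open +-*-Solver
    regroup : ∀ a b c → a * b * c ≡ b * (a * c)
    regroup = solve 3 (λ a b c → a :* b :* c := b :* (a :* c)) refl

  -- The effect of a query on basis vectors

  point : ℤₚ → Q → I
  -- The last coordinate `1#` lets y and z enter the action unscaled; the ancilla keeps w while the
  -- query shifts the vector by y.
  point u q = (u ∷ (copy q ∷ʳ 1#)) , q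

  move : G → I → I
  move a (v , q) = a ▷ v , q

  move-point : ∀ x y z u q →
    move (x , y , z) (point u q) ≡ (((u +ₚ (x · copy q +ₚ z)) ∷ ((copy q ⊕ y) ∷ʳ 1#)) , q)
  move-point x y z u q = cong (_, q) (trans (▷-formula x y z u (copy q) 1#)
    (cong₂ (λ z y → (u +ₚ (x · copy q +ₚ z)) ∷ ((copy q ⊕ y) ∷ʳ 1#)) (*ₚ-identityʳ z)
      (trans (Vec.map-cong *ₚ-identityʳ y) (Vec.map-id y))))
    where
    *ₚ-identityʳ : ∀ a → a *ₚ 1# ≡ a
    *ₚ-identityʳ a = trans (M.*-comm a 1#) (M.*-identityˡ a)

  middle-move-point : ∀ x y z u q → middle (move (x , y , z) (point u q)) ≡ copy q ⊕ y
  middle-move-point x y z u q = trans (cong middle (move-point x y z u q)) (Vec.init-∷ʳ 1# (copy q ⊕ y))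

  outcome-move-point : ∀ x y z u q → outcome (move (x , y , z) (point u q)) ≡ (y , 1# , proj₂ (label q))
  outcome-move-point x y z u q = trans (cong outcome (move-point x y z u q))
    (cong₂ (λ w t → w , t , proj₂ (label q))
      (trans (cong (_⊕ ⊖ copy q) (Vec.init-∷ʳ 1# (copy q ⊕ y))) (V.xyx⁻¹≈y (copy q) y))
      (Vec.last-∷ʳ 1# (copy q ⊕ y)))

  -- The query adds x·w to the first coordinate, and shearing by the same `x` subtracts x·(w + y):
  -- the dependence on w, and so on `q`, disappears.
  shear-move-point : ∀ x y z u q → shear x (move (x , y , z) (point u q)) ≡ u +ₚ (z -ₚ x · y)
  shear-move-point x y z u q = begin
    shear x (move (x , y , z) (point u q))
      ≡⟨ cong (shear x) (move-point x y z u q) ⟩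
    u +ₚ (x · c +ₚ z) -ₚ x · init ((c ⊕ y) ∷ʳ 1#)
      ≡⟨ cong (λ w → u +ₚ (x · c +ₚ z) -ₚ x · w) (Vec.init-∷ʳ 1# (c ⊕ y)) ⟩
    u +ₚ (x · c +ₚ z) -ₚ x · (c ⊕ y)
      ≡⟨ M.+-assoc u (x · c +ₚ z) (-ₚ (x · (c ⊕ y))) ⟩
    u +ₚ (x · c +ₚ z -ₚ x · (c ⊕ y))
      ≡⟨ cong (u +ₚ_) (begin
           x · c +ₚ z -ₚ x · (c ⊕ y)
             ≡⟨ cong (λ k → x · c +ₚ z -ₚ k) (M.·-distribˡ x c y) ⟩
           x · c +ₚ z -ₚ (x · c +ₚ x · y)
             ≡⟨ cong (x · c +ₚ z +ₚ_) (Z.⁻¹-∙-comm (x · c) (x · y)) ⟨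
           x · c +ₚ z +ₚ (-ₚ (x · c) -ₚ x · y)
             ≡⟨ M.interchange (x · c) z (-ₚ (x · c)) (-ₚ (x · y)) ⟩
           (x · c -ₚ x · c) +ₚ (z -ₚ x · y)
             ≡⟨ trans (cong (_+ₚ (z -ₚ x · y)) (M.+-inverseʳ (x · c))) (M.+-identityˡ (z -ₚ x · y)) ⟩
           z -ₚ x · y ∎) ⟩
    u +ₚ (z -ₚ x · y) ∎
    where c = copy q

  effect-of-outcomes : ∀ x y i j t t′ → outcome i ≡ (y , t) → outcome j ≡ (y , t′) →
    effect x y i j ≡ δ finT t t′ * kernel x i j
  effect-of-outcomes x y i j t t′ i↦t j↦t′ = begin
    effect x y i j
      ≡⟨ sum-cong (elements finT) (λ s → cong₂ (λ a b → a * kernel x i j * b) (δ-outcome {i} s i↦t) (δ-outcome {j} s j↦t′)) ⟩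
    ∑ finT (λ s → δ finT t s * kernel x i j * δ finT t′ s)
      ≡⟨ sum-cong (elements finT) (λ s → *-assoc (δ finT t s) (kernel x i j) (δ finT t′ s)) ⟩
    ∑ finT (λ s → δ finT t s * (kernel x i j * δ finT t′ s))
      ≡⟨ ∑-δˡ finT t (λ s → kernel x i j * δ finT t′ s) ⟩
    kernel x i j * δ finT t′ t
      ≡⟨ trans (*-comm (kernel x i j) (δ finT t′ t)) (cong (_* kernel x i j) (δ-sym finT t′ t)) ⟩
    δ finT t t′ * kernel x i j ∎
    where
    δ-outcome : ∀ {k t} s → outcome k ≡ (y , t) → δ (finW ×ᶠ finT) (outcome k) (y , s) ≡ δ finT t s
    δ-outcome {k} {t} s eq = trans (cong (λ o → δ (finW ×ᶠ finT) o (y , s)) eq)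
      (𝟙-cong (_≟_ (finW ×ᶠ finT) (y , t) (y , s)) (_≟_ finT t s) (cong proj₂) (cong (y ,_)))

  -- Both shears carry the same summand z - x·y, so comparing them compares `u` with `u′`; in this
  -- way the unknown central coordinate drops out.
  effect-move-point : ∀ x y z u u′ q q′ →
    effect x y (move (x , y , z) (point u q)) (move (x , y , z) (point u′ q′)) ≡
    δ finR (proj₂ (label q)) (proj₂ (label q′)) *
      (ω⁻¹ * ((δ finℤₚ u u′ - π⁻¹) + π⁻¹ * δ finW (copy q ⊕ y) (copy q′ ⊕ y)))
  effect-move-point x y z u u′ q q′ = begin
    effect x y (move a (point u q)) (move a (point u′ q′))
      ≡⟨ effect-of-outcomes x y (move a (point u q)) (move a (point u′ q′)) (1# , r) (1# , r′)
           (outcome-move-point x y z u q) (outcome-move-point x y z u′ q′) ⟩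
    δ finT (1# , r) (1# , r′) * kernel x (move a (point u q)) (move a (point u′ q′))
      ≡⟨ cong₂ _*_
           (𝟙-cong (_≟_ finT (1# , r) (1# , r′)) (_≟_ finR r r′) (cong proj₂) (cong (1# ,_)))
           (trans (kernel-closed x (move a (point u q)) (move a (point u′ q′)))
             (cong₂ (λ k l → ω⁻¹ * ((k - π⁻¹) + π⁻¹ * l))
               (trans (cong₂ (δ finℤₚ) (shear-move-point x y z u q) (shear-move-point x y z u′ q′))
                 (𝟙-cong (_≟_ finℤₚ (u +ₚ c) (u′ +ₚ c)) (_≟_ finℤₚ u u′) (+ₚ-cancelʳ u u′ c) (cong (_+ₚ c))))
               (cong₂ (δ finW) (middle-move-point x y z u q) (middle-move-point x y z u′ q′)))) ⟩
    δ finR r r′ * (ω⁻¹ * ((δ finℤₚ u u′ - π⁻¹) + π⁻¹ * δ finW (copy q ⊕ y) (copy q′ ⊕ y))) ∎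
    where
    a : G
    a = x , y , z
    r r′ : R
    r  = proj₂ (label q)
    r′ = proj₂ (label q′)
    c : ℤₚ
    c = z -ₚ x · y

  -- The norm of the state and the probability of success

  μ : ℚ
  -- There are 2ω² labels, each contributing two distinct basis vectors with coefficients ±1. The
  -- squared norm before scaling is thus 4ω², with rational root 2ω.
  μ = ½ * ω⁻¹

  open Superposition finI finQ μ

  state : (I → I) → I → ℚ
  state h = superposition (h ∘ point 0#) (h ∘ point 1#)

  card-Q : card finQ ≡ ω * ((1ℚ + 1ℚ) * ω)
  card-Q = trans (sum-lookup (elements finWR) λ _ → 1ℚ)
    (trans (card-× finW finR) (cong (ω *_) (card-× (finFin 2) finW)))

  -- The common end of `state-norm` and `success`: the correct effect has the same expectation as
  -- the identity.
  normalisation : μ * ∑ finQ (λ _ → μ * (1ℚ + 1ℚ)) ≡ 1ℚ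
  normalisation = begin
    μ * ∑ finQ (λ _ → μ * (1ℚ + 1ℚ))
      ≡⟨ cong (μ *_) (trans (sum-const (μ * (1ℚ + 1ℚ)) (elements finQ)) (cong (μ * (1ℚ + 1ℚ) *_) card-Q)) ⟩
    μ * (μ * (1ℚ + 1ℚ) * (ω * ((1ℚ + 1ℚ) * ω)))
      ≡⟨ square ω ω⁻¹ ⟩
    (ω * ω⁻¹) * (ω * ω⁻¹)
      ≡⟨ cong (λ k → k * k) ωω⁻¹≡1 ⟩
    1ℚ ∎
    where
    open +-*-Solver
    square : ∀ a b → (½ * b) * ((½ * b) * (1ℚ + 1ℚ) * (a * ((1ℚ + 1ℚ) * a))) ≡ (a * b) * (a * b)
    square = solve 2 (λ a b → (con ½ :* b) :* ((con ½ :* b) :* con (1ℚ + 1ℚ) :* (a :* (con (1ℚ + 1ℚ) :* a)))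
      := (a :* b) :* (a :* b)) refl

  δ-01 : δ finℤₚ 0# 1# ≡ 0ℚ
  δ-01 = 𝟙-false (_≟_ finℤₚ 0# 1#) (0#≢1# prime)

  δ-10 : δ finℤₚ 1# 0# ≡ 0ℚ
  δ-10 = 𝟙-false (_≟_ finℤₚ 1# 0#) (0#≢1# prime ∘ sym)

  state-norm : ∑ finI (λ i → state id i * state id i) ≡ 1ℚ
  state-norm = begin
    ∑ finI (λ i → ψ i * ψ i)
      -- Inserting the identity matrix turns the norm into a quadratic form.
      ≡⟨ sum-cong is (λ i → cong (ψ i *_) (sym (∑-δˡ finI i ψ))) ⟩
    quadratic is (δ finI) ψ
      ≡⟨ quadratic-superposition (point 0#) (point 1#) (δ finI) ⟩
    μ * ∑ finQ (λ q → μ * ∑ finQ λ r →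
      (δ finI (point 0# q) (point 0# r) - δ finI (point 0# q) (point 1# r)) -
      (δ finI (point 1# q) (point 0# r) - δ finI (point 1# q) (point 1# r)))
      ≡⟨ cong (μ *_) (sum-cong (elements finQ) λ q → cong (μ *_) (trans
           (sum-cong (elements finQ) λ r → interference q r)
           (∑-δˡ finQ q λ _ → 1ℚ + 1ℚ))) ⟩
    μ * ∑ finQ (λ _ → μ * (1ℚ + 1ℚ))
      ≡⟨ normalisation ⟩
    1ℚ ∎
    where
    ψ : I → ℚ
    ψ = state id

    δ-point : ∀ u u′ q r → δ finI (point u q) (point u′ r) ≡ δ finQ q r * δ finℤₚ u u′
    δ-point u u′ q r = sym (𝟙-* (_≟_ finQ q r) (_≟_ finℤₚ u u′) (_≟_ finI (point u q) (point u′ r))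
      (λ { refl refl → refl }) (λ eq → cong proj₂ eq , cong first eq))

    open +-*-Solver
    collect : ∀ d → (d * 1ℚ - d * 0ℚ) - (d * 0ℚ - d * 1ℚ) ≡ d * (1ℚ + 1ℚ)
    collect = solve 1 (λ d → (d :* con 1ℚ :- d :* con 0ℚ) :- (d :* con 0ℚ :- d :* con 1ℚ) := d :* con (1ℚ + 1ℚ)) refl

    interference : ∀ q r →
      (δ finI (point 0# q) (point 0# r) - δ finI (point 0# q) (point 1# r)) -
      (δ finI (point 1# q) (point 0# r) - δ finI (point 1# q) (point 1# r)) ≡ δ finQ q r * (1ℚ + 1ℚ)
    interference q r = trans
      (cong₂ _-_
        (cong₂ _-_ (trans (δ-point 0# 0# q r) (cong (δ finQ q r *_) (δ-refl finℤₚ 0#)))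
                   (trans (δ-point 0# 1# q r) (cong (δ finQ q r *_) δ-01)))
        (cong₂ _-_ (trans (δ-point 1# 0# q r) (cong (δ finQ q r *_) δ-10))
                   (trans (δ-point 1# 1# q r) (cong (δ finQ q r *_) (δ-refl finℤₚ 1#)))))
      (collect (δ finQ q r))

  -- Each r is paired with every w.
  ∑-same-register : ∀ q → ∑ finQ (λ q′ → δ finR (proj₂ (label q)) (proj₂ (label q′))) ≡ ω
  ∑-same-register q = begin
    ∑ finQ (λ q′ → δ finR r (proj₂ (label q′)))
      ≡⟨ sum-lookup (elements finWR) (λ wr → δ finR r (proj₂ wr)) ⟩
    ∑ finWR (λ wr → δ finR r (proj₂ wr))
      ≡⟨ trans (∑-× finW finR _) (sum-cong (elements finW) λ _ → ∑-δ finR r) ⟩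
    ω ∎
    where
    r : R
    r = proj₂ (label q)

  -- The term -1/p and the completion term are the same in all four interference entries and cancel,
  -- |0⟩ - |1⟩ being orthogonal to the trivial character. What remains is 2ω⁻¹ for each of the ω
  -- labels `q′` that share the register r of `q`.
  success : ∀ x y z → quadratic is (effect x y) (state (move (x , y , z))) ≡ 1ℚ
  success x y z = begin
    quadratic is e (state (move a))
      ≡⟨ quadratic-superposition (move a ∘ point 0#) (move a ∘ point 1#) e ⟩
    μ * ∑ finQ (λ q → μ * ∑ finQ λ q′ →
      (e (move a (point 0# q)) (move a (point 0# q′)) - e (move a (point 0# q)) (move a (point 1# q′))) -
      (e (move a (point 1# q)) (move a (point 0# q′)) - e (move a (point 1# q)) (move a (point 1# q′))))
      ≡⟨ cong (μ *_) (sum-cong (elements finQ) λ q → cong (μ *_) (begin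
           ∑ finQ (λ q′ →
             (e (move a (point 0# q)) (move a (point 0# q′)) - e (move a (point 0# q)) (move a (point 1# q′))) -
             (e (move a (point 1# q)) (move a (point 0# q′)) - e (move a (point 1# q)) (move a (point 1# q′))))
             ≡⟨ sum-cong (elements finQ) (interference q) ⟩
           ∑ finQ (λ q′ → δ finR (proj₂ (label q)) (proj₂ (label q′)) * (ω⁻¹ * (1ℚ + 1ℚ)))
             ≡⟨ *-distribʳ-sum (ω⁻¹ * (1ℚ + 1ℚ)) (elements finQ) _ ⟨
           ∑ finQ (λ q′ → δ finR (proj₂ (label q)) (proj₂ (label q′))) * (ω⁻¹ * (1ℚ + 1ℚ))
             ≡⟨ cong (_* (ω⁻¹ * (1ℚ + 1ℚ))) (∑-same-register q) ⟩
           ω * (ω⁻¹ * (1ℚ + 1ℚ))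
             ≡⟨ trans (sym (*-assoc ω ω⁻¹ (1ℚ + 1ℚ))) (cong (_* (1ℚ + 1ℚ)) ωω⁻¹≡1) ⟩
           1ℚ * (1ℚ + 1ℚ) ≡⟨⟩
           1ℚ + 1ℚ ∎)) ⟩
    μ * ∑ finQ (λ _ → μ * (1ℚ + 1ℚ))
      ≡⟨ normalisation ⟩
    1ℚ ∎
    where
    a : G
    a = x , y , z
    e : I → I → ℚ
    e = effect x y

    open +-*-Solver
    collect : ∀ k w b c →
      (k * (w * ((1ℚ - b) + c)) - k * (w * ((0ℚ - b) + c))) - (k * (w * ((0ℚ - b) + c)) - k * (w * ((1ℚ - b) + c)))
        ≡ k * (w * (1ℚ + 1ℚ))
    collect = solve 4 (λ k w b c →
      (k :* (w :* ((con 1ℚ :- b) :+ c)) :- k :* (w :* ((con 0ℚ :- b) :+ c))) :-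
      (k :* (w :* ((con 0ℚ :- b) :+ c)) :- k :* (w :* ((con 1ℚ :- b) :+ c)))
        := k :* (w :* con (1ℚ + 1ℚ))) refl

    interference : ∀ q q′ →
      (e (move a (point 0# q)) (move a (point 0# q′)) - e (move a (point 0# q)) (move a (point 1# q′))) -
      (e (move a (point 1# q)) (move a (point 0# q′)) - e (move a (point 1# q)) (move a (point 1# q′)))
        ≡ δ finR (proj₂ (label q)) (proj₂ (label q′)) * (ω⁻¹ * (1ℚ + 1ℚ))
    interference q q′ = trans
      (cong₂ _-_
        (cong₂ _-_ (entry 0# 0# (δ-refl finℤₚ 0#)) (entry 0# 1# δ-01))
        (cong₂ _-_ (entry 1# 0# δ-10) (entry 1# 1# (δ-refl finℤₚ 1#))))
      (collect (δ finR (proj₂ (label q)) (proj₂ (label q′))) ω⁻¹ π⁻¹ (π⁻¹ * δ finW (copy q ⊕ y) (copy q′ ⊕ y)))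
      where
      entry : ∀ u u′ {d} → δ finℤₚ u u′ ≡ d → e (move a (point u q)) (move a (point u′ q′)) ≡
        δ finR (proj₂ (label q)) (proj₂ (label q′)) *
          (ω⁻¹ * ((d - π⁻¹) + π⁻¹ * δ finW (copy q ⊕ y) (copy q′ ⊕ y)))
      entry u u′ refl = effect-move-point x y z u u′ q q′

  -- The product of deltas is an entry of the query operator; it says that `i` is `move a k`, so
  -- that the query replaces each point by its image.
  state-move : ∀ a i → ∑ finI (λ k →
    (δ finX (proj₁ i) (a ▷ proj₁ k) * δ finQ (proj₂ i) (proj₂ k)) * state id k) ≡ state (move a) i
  state-move a i@(v , q) = trans
    (∑-superposition (point 0#) (point 1#) λ k → δ finX v (a ▷ proj₁ k) * δ finQ q (proj₂ k))
    (cong (μ *_) (sum-cong (elements finQ) λ r → cong₂ _-_ (moved (point 0# r)) (moved (point 1# r))))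
    where
    moved : ∀ k → δ finX v (a ▷ proj₁ k) * δ finQ q (proj₂ k) ≡ δ finI (move a k) i
    moved k = trans (δ-× finX finQ v q (a ▷ proj₁ k) (proj₂ k)) (δ-sym finI i (move a k))

  -- Cosets of the centre

  𝒫 : CosetProblem
  𝒫 = heisenbergProblem p n

  open CosetProblem 𝒫 using (SameCoset; sameCoset?; transversal; ∣G∣≢0)

  coset : G → W × W
  coset (x , y , z) = x , y

  sameCoset⇒≡ : ∀ {a b} → SameCoset a b → coset a ≡ coset b
  sameCoset⇒≡ (x≡ , y≡) = cong₂ _,_ (difference x≡) (difference y≡)
    where
    difference : ∀ {x x′ : W} → ⊖ x ⊕ x′ ≡ 0ᵛ → x ≡ x′
    difference {x} {x′} eq = sym (trans (V.inverseʳ-unique (⊖ x) x′ eq) (V.⁻¹-involutive x))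

  ≡⇒sameCoset : ∀ {a b} → coset a ≡ coset b → SameCoset a b
  ≡⇒sameCoset {x , y , _} refl = M.⊕-inverseˡ x , M.⊕-inverseˡ y

  -- The equivalence for which `deduplicate-!` shows the entries of the transversal to be pairwise
  -- inequivalent.
  cosetSetoid : DecSetoid 0ℓ 0ℓ
  cosetSetoid = record
    { Carrier = G
    ; _≈_     = SameCoset
    ; isDecEquivalence = record
      { isEquivalence = record
        { refl  = λ {a} → ≡⇒sameCoset {a} {a} refl
        ; sym   = λ {a} {b} a~b → ≡⇒sameCoset {b} {a} (sym (sameCoset⇒≡ {a} {b} a~b))
        ; trans = λ {a} {b} {c} a~b b~c →
            ≡⇒sameCoset {a} {c} (trans (sameCoset⇒≡ {a} {b} a~b) (sameCoset⇒≡ {b} {c} b~c))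
        }
      ; _≟_ = sameCoset?
      }
    }

  -- A coset is determined by (x , y), so the transversal enumerates `W × W`; `∑-unique` compares it
  -- with the product enumeration.
  finCosets : Finite (W × W)
  finCosets = record
    { elements = map coset transversal
    ; complete = λ (x , y) → Any.map⁺ (Any.deduplicate⁺ sameCoset?
        (λ {a} {b} b~a eq → trans eq (sym (sameCoset⇒≡ {b} {a} b~a)))
        -- `0#` selects one element of the coset; deduplication keeps some element equivalent to it.
        (Any.map (cong coset) (complete finG (x , y , 0#))))
    ; unique   = AllPairs.map⁺ (AllPairs.map (λ {a} {b} a≁b eq → a≁b (≡⇒sameCoset {a} {b} eq))
        (deduplicate-! cosetSetoid (elements finG)))
    ; _≟_      = _≟_ (finW ×ᶠ finW)
    }

  ∑-transversal : ∀ i j → sum transversal (λ a → effect (proj₁ a) (proj₁ (proj₂ a)) i j) ≡ δ finI i j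
  ∑-transversal i j = begin
    sum transversal (λ a → effect (proj₁ a) (proj₁ (proj₂ a)) i j)
      ≡⟨ sum-map coset transversal (λ (x , y) → effect x y i j) ⟨
    ∑ finCosets (λ (x , y) → effect x y i j)
      ≡⟨ ∑-unique finCosets (finW ×ᶠ finW) _ ⟩
    ∑ (finW ×ᶠ finW) (λ (x , y) → effect x y i j)
      ≡⟨ ∑-effect i j ⟩
    δ finI i j ∎

  -- From rational matrices to the quantum algorithm

  open LinearAlgebra finI using (idᵒ; IsUnitary; ⟨_∣_⟩; _$ᵒ_)

  idᵒ↝ : ∀ i j → idᵒ i j ↝ δ finI i j
  idᵒ↝ i j = ↝-𝟙 (_≟_ finI i j)

  idᵒ-unitary : IsUnitary idᵒ
  idᵒ-unitary =
      (λ i k → ↝⇒≈ᶜ (↝-sum is λ j → ↝-* (↝-conj (idᵒ↝ j i)) (idᵒ↝ j k))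
        (↝-subst (idᵒ↝ i k) (sym (trans (sum-cong is λ j → cong₂ _*_ (δ-sym finI j i) (δ-sym finI j k)) (∑-δδ finI i k)))))
    , (λ i k → ↝⇒≈ᶜ (↝-sum is λ j → ↝-* (idᵒ↝ i j) (↝-conj (idᵒ↝ k j)))
        (↝-subst (idᵒ↝ i k) (sym (∑-δδ finI i k))))

  povm : CosetPOVM 𝒫 finI
  povm = record
    { E          = E
    ; E-cong     = λ {a} {b} a~b i j → ↝⇒≈ᶜ {E a i j} {E b i j} (↝-ℚ _)
        (↝-subst (↝-ℚ _) (cong (λ (x , y) → effect x y i j) (sym (sameCoset⇒≡ {a} {b} a~b))))
    ; E-positive = λ (x , y , _) → isPositive finI (λ i j → ↝-ℚ (effect x y i j)) (effect-sym x y) (effect-psd x y)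
    ; E-complete = λ i j → ↝⇒≈ᶜ (↝-sum transversal λ a → ↝-ℚ (effect (proj₁ a) (proj₁ (proj₂ a)) i j))
        (↝-subst (idᵒ↝ i j) (sym (∑-transversal i j)))
    }
    where
    E : G → Operator I
    E (x , y , z) i j = ℚ→ℂ (effect x y i j)

  algorithm : SingleQueryAlgorithm 𝒫
  algorithm = record
    { N          = N
    ; N≥1        = Membership.∈-length (complete finWR (0ᵛ , Fin.zero , 0ᵛ))
    ; ψ          = λ i → ℚ→ℂ (state id i)
    ; ψ-unit     = ↝⇒≈ᶜ (↝-sum is λ i → ↝-* (↝-conj (↝-ℚ (state id i))) (↝-ℚ (state id i)))
        (↝-subst (↝-ℚ 1ℚ) (sym state-norm))
    -- The measurement acts directly on the output of the query.
    ; U₁         = idᵒ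
    ; U₁-unitary = idᵒ-unitary
    ; povm       = povm
    }

  open SingleQueryAlgorithm algorithm using (ψ[_]; successProbability)

  ψ[]↝ : ∀ a i → ψ[ a ] i ↝ state (move a) i
  ψ[]↝ a i = ↝-subst
    (↝-sum is λ j → ↝-* (idᵒ↝ i j) (↝-sum is λ k →
      ↝-* (↝-* (↝-𝟙 (_≟_ finX (proj₁ j) (a ▷ proj₁ k))) (↝-𝟙 (_≟_ finQ (proj₂ j) (proj₂ k))))
          (↝-ℚ (state id k))))
    (trans (∑-δˡ finI i _) (state-move a i))

  -- Every single `a` is identified with probability 1 by `success`, so the average over the group
  -- is 1.
  solvable : SolvableWithProbability 𝒫 1ᶜ
  solvable = algorithm , ↝⇒≈ᶜ {successProbability} {1ᶜ}
    (↝-subst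
      (↝-* (↝-ℚ _) (↝-sum (elements finG) λ a@(x , y , z) →
        ↝-subst (↝-sum is λ i → ↝-* (↝-conj (ψ[]↝ a i)) (↝-sum is λ j → ↝-* (↝-ℚ (effect x y i j)) (ψ[]↝ a j)))
          (success x y z)))
      (1/length*sum-1 (elements finG) {{∣G∣≢0}}))
    (↝-ℚ 1ℚ)

theorem20 : ∀ (p : ℕ) (prime : Prime p) (n : ℕ) → n ≥ 1 →
    SolvableWithProbability (heisenbergProblem p {{prime⇒nonZero prime}} n) 1ᶜ
theorem20 p p-prime n _ = Algorithm.solvable p {{prime⇒nonZero p-prime}} p-prime n
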